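{- For every fixed integer $n\ge 3$, we have $$m(v,n)\le\left[\left(1+2^{(3-n)/2}\right)(n-1)2^{n-1}+o(1)\right]v\log v,$$ where $o(1)\to 0$ as $v\to\infty$.
   Context: All graphs are finite and simple. A graph $G$ is $n$-existentially closed ($n$-e.c.) if for all subsets $S\subseteq V(G)$ with $|S|=n$ and all partitions $S=A\sqcup B$ (with $A$ or $B$ possibly empty), there exists a vertex in $V(G)\setminus S$ adjacent to all vertices in $A$ and to no vertices in $B$. $m(v,n)$ denotes the minimum number of edges in an $n$-e.c. graph with $v$ vertices. Here $\log$ is the natural logarithm. -}

module Defs where

open import Data.Fin.Base using (Fin)
open import Data.Fin.Properties using (_<?_)
open import Data.Fin.Subset using (Subset; _∈_; _∉_; _∪_; _∩_; ⊥)
  renaming (∣_∣ to card)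
open import Data.Integer.Base as ℤ using (ℤ; +_; -[1+_])
import Data.Integer.Properties as ℤ
open import Data.List.Base using (length; filter; allFin; cartesianProduct)
open import Data.Nat.Base as ℕ using (ℕ; zero; suc)
import Data.Nat.Properties as ℕ
import Data.Nat.DivMod as ℕ
import Data.Nat.Solver as ℕ-Solver
open import Data.Product.Base using (∃; _×_; _,_)
open import Data.Rational.Base as ℚ using (ℚ; 0ℚ; 1ℚ; ½; ↥_; ↧ₙ_; _/_)
import Data.Rational.Properties as ℚ
import Data.Rational.Solver as ℚ-Solver
import Data.Rational.Unnormalised.Base as ℚᵘ
import Data.Rational.Unnormalised.Properties as ℚᵘ
open import Data.Sum.Base using (inj₁; inj₂)
open import Level using (0ℓ)
open import Relation.Binary.Core using (Rel)
open import Relation.Binary.Definitions using (Symmetric; Irreflexive; Decidable)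
open import Relation.Binary.PropositionalEquality
open import Relation.Nullary.Decidable using (yes; no; _×-dec_)
open import Relation.Nullary.Negation using (¬_)

record Graph (v : ℕ) : Set₁ where
  infix 4 _~_ _~?_
  field
    _~_      : Rel (Fin v) 0ℓ
    _~?_     : Decidable _~_
    ~-sym    : Symmetric _~_
    ~-irrefl : Irreflexive _≡_ _~_

edgeCount : ∀ {v} → Graph v → ℕ
edgeCount {v} G =
  length (filter (λ (i , j) → (i <? j) ×-dec (i ~? j))
                 (cartesianProduct (allFin v) (allFin v)))
  where open Graph G

IsExistentiallyClosed : ℕ → ∀ {v} → Graph v → Set
IsExistentiallyClosed n {v} G =
  ∀ (S A B : Subset v) → card S ≡ n → A ∪ B ≡ S → A ∩ B ≡ ⊥ →
  ∃ λ z → z ∉ S × (∀ {a} → a ∈ A → z ~ a) × (∀ {b} → b ∈ B → ¬ (z ~ b))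
  where open Graph G

-- IsMinEdgeCount v n m says that m(v,n) is defined and equal to m.  For
-- some v there is no n-e.c. graph on v vertices, so m(v,n) is partial.
IsMinEdgeCount : ℕ → ℕ → ℕ → Set₁
IsMinEdgeCount v n m =
  (∃ λ (G : Graph v) → IsExistentiallyClosed n G × edgeCount G ≡ m) ×
  (∀ (G : Graph v) → IsExistentiallyClosed n G → m ℕ.≤ edgeCount G)

-- Reals are Cauchy sequences of rationals; operations are termwise.
IsCauchy : (ℕ → ℚ) → Set
IsCauchy x = ∀ ε → 0ℚ ℚ.< ε →
  ∃ λ N → ∀ m n → N ℕ.≤ m → N ℕ.≤ n → ℚ.∣ x m ℚ.- x n ∣ ℚ.≤ ε

record ℝ : Set where
  constructor mkℝ
  field
    approx : ℕ → ℚ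
    cauchy : IsCauchy approx

open ℝ public

infix 4 _≤_

_≤_ : Rel ℝ 0ℓ
x ≤ y = ∀ ε → 0ℚ ℚ.< ε →
  ∃ λ N → ∀ n → N ℕ.≤ n → approx x n ℚ.≤ approx y n ℚ.+ ε

fromℚ : ℚ → ℝ
approx (fromℚ q) _ = q
cauchy (fromℚ q) ε 0<ε = 0 , λ _ _ _ _ →
  subst (λ d → ℚ.∣ d ∣ ℚ.≤ ε) (sym (ℚ.+-inverseʳ q)) (ℚ.<⇒≤ 0<ε)

fromℕ : ℕ → ℝ
fromℕ n = fromℚ (+ n / 1)

module ℚS = ℚ-Solver.+-*-Solver
module ℕS = ℕ-Solver.+-*-Solver

half+half : ∀ ε → ε ℚ.* ½ ℚ.+ ε ℚ.* ½ ≡ ε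
half+half ε = trans (sym (ℚ.*-distribˡ-+ ε ½ ½)) (ℚ.*-identityʳ ε)

0<p*q : ∀ {p q} → 0ℚ ℚ.< p → 0ℚ ℚ.< q → 0ℚ ℚ.< p ℚ.* q
0<p*q {p} {q} 0<p 0<q = ℚ.positive⁻¹ (p ℚ.* q) {{ℚ.pos*pos⇒pos p {{ℚ.positive 0<p}} q {{ℚ.positive 0<q}}}}

0<half : ∀ {ε} → 0ℚ ℚ.< ε → 0ℚ ℚ.< ε ℚ.* ½
0<half 0<ε = 0<p*q 0<ε (ℚ.positive⁻¹ ½)

p≤q+r⇒p-q≤r : ∀ {p q r} → p ℚ.≤ q ℚ.+ r → p ℚ.- q ℚ.≤ r
p≤q+r⇒p-q≤r {p} {q} {r} h =
  subst (p ℚ.- q ℚ.≤_)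
    (ℚS.solve 2 (λ q r → (q ℚS.:+ r) ℚS.:- q ℚS.:= r) refl q r)
    (ℚ.+-monoˡ-≤ (ℚ.- q) h)

abs-≤ : ∀ {p q ε} → p ℚ.≤ q ℚ.+ ε → q ℚ.≤ p ℚ.+ ε → ℚ.∣ p ℚ.- q ∣ ℚ.≤ ε
abs-≤ {p} {q} {ε} h₁ h₂ with ℚ.∣p∣≡p∨∣p∣≡-p (p ℚ.- q)
... | inj₁ e = subst (ℚ._≤ ε) (sym e) (p≤q+r⇒p-q≤r h₁)
... | inj₂ e = subst (ℚ._≤ ε)
  (trans (ℚS.solve 2 (λ p q → q ℚS.:- p ℚS.:= ℚS.:- (p ℚS.:- q)) refl p q) (sym e))
  (p≤q+r⇒p-q≤r h₂)

∣p∣≤∣q∣+∣p-q∣ : ∀ p q → ℚ.∣ p ∣ ℚ.≤ ℚ.∣ q ∣ ℚ.+ ℚ.∣ p ℚ.- q ∣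
∣p∣≤∣q∣+∣p-q∣ p q =
  subst (λ r → ℚ.∣ r ∣ ℚ.≤ ℚ.∣ q ∣ ℚ.+ ℚ.∣ p ℚ.- q ∣)
    (ℚS.solve 2 (λ p q → q ℚS.:+ (p ℚS.:- q) ℚS.:= p) refl p q)
    (ℚ.∣p+q∣≤∣p∣+∣q∣ q (p ℚ.- q))

∣p-q∣≡∣q-p∣ : ∀ p q → ℚ.∣ p ℚ.- q ∣ ≡ ℚ.∣ q ℚ.- p ∣
∣p-q∣≡∣q-p∣ p q =
  trans (sym (ℚ.∣-p∣≡∣p∣ (p ℚ.- q)))
    (cong ℚ.∣_∣ (ℚS.solve 2 (λ p q → ℚS.:- (p ℚS.:- q) ℚS.:= q ℚS.:- p) refl p q))

∣∣p∣-∣q∣∣≤∣p-q∣ : ∀ p q → ℚ.∣ ℚ.∣ p ∣ ℚ.- ℚ.∣ q ∣ ∣ ℚ.≤ ℚ.∣ p ℚ.- q ∣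
∣∣p∣-∣q∣∣≤∣p-q∣ p q = abs-≤ (∣p∣≤∣q∣+∣p-q∣ p q)
  (subst (λ d → ℚ.∣ q ∣ ℚ.≤ ℚ.∣ p ∣ ℚ.+ d) (∣p-q∣≡∣q-p∣ q p) (∣p∣≤∣q∣+∣p-q∣ q p))

bound : ∀ {x} → IsCauchy x →
  ∃ λ b → 0ℚ ℚ.< b × (∃ λ N → ∀ n → N ℕ.≤ n → ℚ.∣ x n ∣ ℚ.≤ b)
bound {x} cx with cx 1ℚ (ℚ.positive⁻¹ 1ℚ)
... | N , h = ℚ.∣ x N ∣ ℚ.+ 1ℚ
  , ℚ.+-mono-≤-< (ℚ.0≤∣p∣ (x N)) (ℚ.positive⁻¹ 1ℚ)
  , N , λ n N≤n → ℚ.≤-trans (∣p∣≤∣q∣+∣p-q∣ (x n) (x N))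
                    (ℚ.+-monoʳ-≤ ℚ.∣ x N ∣ (h n N N≤n ℕ.≤-refl))

scaled : ∀ {ε b} → 0ℚ ℚ.< ε → 0ℚ ℚ.< b → ∃ λ η → 0ℚ ℚ.< η × η ℚ.* b ≡ ε
scaled {ε} {b} 0<ε 0<b = ε ℚ.* ℚ.1/ b
  , 0<p*q 0<ε (ℚ.positive⁻¹ (ℚ.1/ b) {{ℚ.1/pos⇒pos b}})
  , trans (ℚ.*-assoc ε (ℚ.1/ b) b)
      (trans (cong (ε ℚ.*_) (ℚ.*-inverseˡ b)) (ℚ.*-identityʳ ε))
  where instance
    _ = ℚ.positive 0<b
    _ = ℚ.pos⇒nonZero b

∣p*q∣≤ : ∀ p q {a b} → ℚ.∣ p ∣ ℚ.≤ a → ℚ.∣ q ∣ ℚ.≤ b → ℚ.∣ p ℚ.* q ∣ ℚ.≤ a ℚ.* b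
∣p*q∣≤ p q {a} {b} p≤a q≤b = begin
  ℚ.∣ p ℚ.* q ∣       ≡⟨ ℚ.∣p*q∣≡∣p∣*∣q∣ p q ⟩
  ℚ.∣ p ∣ ℚ.* ℚ.∣ q ∣ ≤⟨ ℚ.*-monoʳ-≤-nonNeg ℚ.∣ q ∣ {{ℚ.∣-∣-nonNeg q}} p≤a ⟩
  a ℚ.* ℚ.∣ q ∣       ≤⟨ ℚ.*-monoˡ-≤-nonNeg a {{ℚ.nonNegative (ℚ.≤-trans (ℚ.0≤∣p∣ p) p≤a)}} q≤b ⟩
  a ℚ.* b             ∎
  where open ℚ.≤-Reasoning

+-cauchy : ∀ {x y} → IsCauchy x → IsCauchy y → IsCauchy (λ k → x k ℚ.+ y k)
+-cauchy {x} {y} cx cy ε 0<ε with cx (ε ℚ.* ½) (0<half 0<ε) | cy (ε ℚ.* ½) (0<half 0<ε)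
... | M , hx | N , hy = M ℕ.⊔ N , λ m n ≤m ≤n → begin
  ℚ.∣ (x m ℚ.+ y m) ℚ.- (x n ℚ.+ y n) ∣
    ≡⟨ cong ℚ.∣_∣ (ℚS.solve 4 (λ a b c d → (a ℚS.:+ b) ℚS.:- (c ℚS.:+ d) ℚS.:= (a ℚS.:- c) ℚS.:+ (b ℚS.:- d)) refl (x m) (y m) (x n) (y n)) ⟩
  ℚ.∣ (x m ℚ.- x n) ℚ.+ (y m ℚ.- y n) ∣
    ≤⟨ ℚ.∣p+q∣≤∣p∣+∣q∣ (x m ℚ.- x n) (y m ℚ.- y n) ⟩
  ℚ.∣ x m ℚ.- x n ∣ ℚ.+ ℚ.∣ y m ℚ.- y n ∣
    ≤⟨ ℚ.+-mono-≤ (hx m n (ℕ.m⊔n≤o⇒m≤o M N ≤m) (ℕ.m⊔n≤o⇒m≤o M N ≤n))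
                  (hy m n (ℕ.m⊔n≤o⇒n≤o M N ≤m) (ℕ.m⊔n≤o⇒n≤o M N ≤n)) ⟩
  ε ℚ.* ½ ℚ.+ ε ℚ.* ½
    ≡⟨ half+half ε ⟩
  ε ∎
  where open ℚ.≤-Reasoning

mul-diff : ∀ a b c d → a ℚ.* b ℚ.- c ℚ.* d ≡ (a ℚ.- c) ℚ.* b ℚ.+ (b ℚ.- d) ℚ.* c
mul-diff a b c d = begin
  a ℚ.* b ℚ.- c ℚ.* d
    ≡⟨ ℚS.solve 3 (λ p q r → p ℚS.:- r ℚS.:= (p ℚS.:- q) ℚS.:+ (q ℚS.:- r)) refl (a ℚ.* b) (c ℚ.* b) (c ℚ.* d) ⟩
  (a ℚ.* b ℚ.- c ℚ.* b) ℚ.+ (c ℚ.* b ℚ.- c ℚ.* d)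
    ≡⟨ cong₂ ℚ._+_ (*-sub a c b)
         (trans (cong₂ ℚ._-_ (ℚ.*-comm c b) (ℚ.*-comm c d)) (*-sub b d c)) ⟩
  (a ℚ.- c) ℚ.* b ℚ.+ (b ℚ.- d) ℚ.* c ∎
  where
  open ≡-Reasoning
  *-sub : ∀ p q r → p ℚ.* r ℚ.- q ℚ.* r ≡ (p ℚ.- q) ℚ.* r
  *-sub p q r = trans (cong (p ℚ.* r ℚ.+_) (ℚ.neg-distribˡ-* q r))
                      (sym (ℚ.*-distribʳ-+ r p (ℚ.- q)))

*-close : ∀ p q r s {a b η θ} → ℚ.∣ p ℚ.- r ∣ ℚ.≤ η → ℚ.∣ q ℚ.- s ∣ ℚ.≤ θ →
          ℚ.∣ q ∣ ℚ.≤ b → ℚ.∣ r ∣ ℚ.≤ a →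
          ℚ.∣ p ℚ.* q ℚ.- r ℚ.* s ∣ ℚ.≤ η ℚ.* b ℚ.+ θ ℚ.* a
*-close p q r s {a} {b} {η} {θ} h₁ h₂ h₃ h₄ = begin
  ℚ.∣ p ℚ.* q ℚ.- r ℚ.* s ∣
    ≡⟨ cong ℚ.∣_∣ (mul-diff p q r s) ⟩
  ℚ.∣ (p ℚ.- r) ℚ.* q ℚ.+ (q ℚ.- s) ℚ.* r ∣
    ≤⟨ ℚ.∣p+q∣≤∣p∣+∣q∣ ((p ℚ.- r) ℚ.* q) ((q ℚ.- s) ℚ.* r) ⟩
  ℚ.∣ (p ℚ.- r) ℚ.* q ∣ ℚ.+ ℚ.∣ (q ℚ.- s) ℚ.* r ∣
    ≤⟨ ℚ.+-mono-≤ (∣p*q∣≤ (p ℚ.- r) q h₁ h₃) (∣p*q∣≤ (q ℚ.- s) r h₂ h₄) ⟩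
  η ℚ.* b ℚ.+ θ ℚ.* a ∎
  where open ℚ.≤-Reasoning

*-cauchy : ∀ {x y} → IsCauchy x → IsCauchy y → IsCauchy (λ k → x k ℚ.* y k)
*-cauchy {x} {y} cx cy ε 0<ε =
  let a , 0<a , A , x≤a = bound cx
      b , 0<b , B , y≤b = bound cy
      η , 0<η , ηb≡ε/2 = scaled (0<half 0<ε) 0<b
      θ , 0<θ , θa≡ε/2 = scaled (0<half 0<ε) 0<a
      M , hx = cx η 0<η
      N , hy = cy θ 0<θ
      AM = A ℕ.⊔ M
      BN = B ℕ.⊔ N
  in AM ℕ.⊔ BN , λ m n ≤m ≤n →
     let AM≤m = ℕ.m⊔n≤o⇒m≤o AM BN ≤m
         AM≤n = ℕ.m⊔n≤o⇒m≤o AM BN ≤n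
         BN≤m = ℕ.m⊔n≤o⇒n≤o AM BN ≤m
         BN≤n = ℕ.m⊔n≤o⇒n≤o AM BN ≤n
     in subst (ℚ.∣ x m ℚ.* y m ℚ.- x n ℚ.* y n ∣ ℚ.≤_)
          (trans (cong₂ ℚ._+_ ηb≡ε/2 θa≡ε/2) (half+half ε))
          (*-close (x m) (y m) (x n) (y n)
            (hx m n (ℕ.m⊔n≤o⇒n≤o A M AM≤m) (ℕ.m⊔n≤o⇒n≤o A M AM≤n))
            (hy m n (ℕ.m⊔n≤o⇒n≤o B N BN≤m) (ℕ.m⊔n≤o⇒n≤o B N BN≤n))
            (y≤b m (ℕ.m⊔n≤o⇒m≤o B N BN≤m))
            (x≤a n (ℕ.m⊔n≤o⇒m≤o A M AM≤n)))

infixl 6 _+_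
infixl 7 _*_

_+_ : ℝ → ℝ → ℝ
approx (x + y) k = approx x k ℚ.+ approx y k
cauchy (x + y) = +-cauchy {approx x} {approx y} (cauchy x) (cauchy y)

_*_ : ℝ → ℝ → ℝ
approx (x * y) k = approx x k ℚ.* approx y k
cauchy (x * y) = *-cauchy {approx x} {approx y} (cauchy x) (cauchy y)

∣_∣ : ℝ → ℝ
approx ∣ x ∣ k = ℚ.∣ approx x k ∣
cauchy ∣ x ∣ ε 0<ε with cauchy x ε 0<ε
... | N , h = N , λ m n N≤m N≤n →
  ℚ.≤-trans (∣∣p∣-∣q∣∣≤∣p-q∣ (approx x m) (approx x n)) (h m n N≤m N≤n)

TendsToZero : (ℕ → ℝ) → Set
TendsToZero f = ∀ ε → 0ℚ ℚ.< ε → ∃ λ N → ∀ k → N ℕ.≤ k → ∣ f k ∣ ≤ fromℚ ε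

/-≤ : ∀ a b c d .{{_ : ℕ.NonZero b}} .{{_ : ℕ.NonZero d}} →
      a ℕ.* d ℕ.≤ c ℕ.* b → (+ a) / b ℚ.≤ (+ c) / d
/-≤ a b@(suc _) c d@(suc _) h = ℚ.toℚᵘ-cancel-≤ (begin
  ℚ.toℚᵘ ((+ a) / b) ≃⟨ ℚ.toℚᵘ-fromℚᵘ ((+ a) ℚᵘ./ b) ⟩
  (+ a) ℚᵘ./ b       ≤⟨ ℚᵘ.*≤* (subst₂ ℤ._≤_ (ℤ.pos-* a d) (ℤ.pos-* c b) (ℤ.+≤+ h)) ⟩
  (+ c) ℚᵘ./ d       ≃⟨ ℚ.toℚᵘ-fromℚᵘ ((+ c) ℚᵘ./ d) ⟨
  ℚ.toℚᵘ ((+ c) / d) ∎)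
  where open ℚᵘ.≤-Reasoning

archimedean : ∀ ε → 0ℚ ℚ.< ε → ∃ λ N → (+ 1) / suc N ℚ.≤ ε
archimedean ε 0<ε with ε | ℚ.positive 0<ε
... | e@(ℚ.mkℚ ℤ.+[1+ p ] d _) | _ = d ,
  subst ((+ 1) / suc d ℚ.≤_) (ℚ.↥p/↧p≡p e)
    (/-≤ 1 (suc d) (suc p) (suc d) (ℕ.*-monoˡ-≤ (suc d) {1} {suc p} (ℕ.s≤s ℕ.z≤n)))

rate⇒cauchy : ∀ {x} → (∀ m n → x m ℚ.≤ x n ℚ.+ (+ 1) / suc n) → IsCauchy x
rate⇒cauchy {x} h ε 0<ε with archimedean ε 0<ε
... | N , 1/N≤ε = N , λ m n N≤m N≤n → abs-≤ (close m n N≤n) (close n m N≤m)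
  where
  close : ∀ m n → N ℕ.≤ n → x m ℚ.≤ x n ℚ.+ ε
  close m n N≤n = ℚ.≤-trans (h m n) (ℚ.+-monoʳ-≤ (x n) (ℚ.≤-trans
    (/-≤ 1 (suc n) 1 (suc N) (ℕ.*-monoʳ-≤ 1 (ℕ.s≤s N≤n))) 1/N≤ε))

-- ⌊√ n ⌋
isqrt : ℕ → ℕ
isqrt zero = zero
isqrt (suc n) with suc (isqrt n) ℕ.* suc (isqrt n) ℕ.≤? suc n
... | yes _ = suc (isqrt n)
... | no  _ = isqrt n

isqrt-lower : ∀ n → isqrt n ℕ.* isqrt n ℕ.≤ n
isqrt-lower zero = ℕ.z≤n
isqrt-lower (suc n) with suc (isqrt n) ℕ.* suc (isqrt n) ℕ.≤? suc n
... | yes p = p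
... | no  _ = ℕ.m≤n⇒m≤1+n (isqrt-lower n)

isqrt-upper : ∀ n → n ℕ.< suc (isqrt n) ℕ.* suc (isqrt n)
isqrt-upper zero = ℕ.s≤s ℕ.z≤n
isqrt-upper (suc n) with suc (isqrt n) ℕ.* suc (isqrt n) ℕ.≤? suc n
... | yes _ = ℕ.<-≤-trans (ℕ.s≤s (isqrt-upper n))
  (ℕ.≤-<-trans (ℕ.*-monoʳ-≤ (suc (isqrt n)) (ℕ.n≤1+n (suc (isqrt n))))
               (ℕ.*-monoˡ-< (suc (suc (isqrt n))) (ℕ.n<1+n (suc (isqrt n)))))
... | no ¬p = ℕ.≰⇒> ¬p

-- ⌊ s √q ⌋, since j ≤ s √(a/d) iff j² ≤ ⌊ a s² / d ⌋
⌊_√_⌋ : ℕ → (q : ℚ) → ℕ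
⌊ s √ q ⌋ = isqrt (ℤ.∣ ↥ q ∣ ℕ.* (s ℕ.* s) ℕ./ ↧ₙ q)

√-lower : ∀ s q → ⌊ s √ q ⌋ ℕ.* ⌊ s √ q ⌋ ℕ.* ↧ₙ q ℕ.≤ ℤ.∣ ↥ q ∣ ℕ.* (s ℕ.* s)
√-lower s q = ℕ.≤-trans
  (ℕ.*-monoˡ-≤ (↧ₙ q) (isqrt-lower (ℤ.∣ ↥ q ∣ ℕ.* (s ℕ.* s) ℕ./ ↧ₙ q)))
  (ℕ.m/n*n≤m (ℤ.∣ ↥ q ∣ ℕ.* (s ℕ.* s)) (↧ₙ q))

√-upper : ∀ s q → ℤ.∣ ↥ q ∣ ℕ.* (s ℕ.* s) ℕ.< suc ⌊ s √ q ⌋ ℕ.* suc ⌊ s √ q ⌋ ℕ.* ↧ₙ q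
√-upper s q = begin-strict
  y                        ≡⟨ ℕ.m≡m%n+[m/n]*n y d ⟩
  y ℕ.% d ℕ.+ y ℕ./ d ℕ.* d <⟨ ℕ.+-monoˡ-< (y ℕ./ d ℕ.* d) (ℕ.m%n<n y d) ⟩
  suc (y ℕ./ d) ℕ.* d      ≤⟨ ℕ.*-monoˡ-≤ d (isqrt-upper (y ℕ./ d)) ⟩
  suc ⌊ s √ q ⌋ ℕ.* suc ⌊ s √ q ⌋ ℕ.* d ∎
  where
  open ℕ.≤-Reasoning
  d = ↧ₙ q
  y = ℤ.∣ ↥ q ∣ ℕ.* (s ℕ.* s)

square-cancel-< : ∀ {a b} → a ℕ.* a ℕ.< b ℕ.* b → a ℕ.< b
square-cancel-< {a} {b} h = ℕ.≰⇒> λ b≤a → ℕ.<⇒≱ h (ℕ.*-mono-≤ b≤a b≤a)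

√-cross : ∀ s t q .{{_ : ℕ.NonZero s}} .{{_ : ℕ.NonZero t}} →
          ⌊ s √ q ⌋ ℕ.* t ℕ.< suc ⌊ t √ q ⌋ ℕ.* s
√-cross s t q = square-cancel-< (ℕ.*-cancelʳ-< (↧ₙ q) _ _ (begin-strict
  (i ℕ.* t) ℕ.* (i ℕ.* t) ℕ.* d
    ≡⟨ ℕS.solve 3 (λ i t d → (i ℕS.:* t) ℕS.:* (i ℕS.:* t) ℕS.:* d ℕS.:= i ℕS.:* i ℕS.:* d ℕS.:* (t ℕS.:* t)) refl i t d ⟩
  i ℕ.* i ℕ.* d ℕ.* (t ℕ.* t)
    ≤⟨ ℕ.*-monoˡ-≤ (t ℕ.* t) (√-lower s q) ⟩
  a ℕ.* (s ℕ.* s) ℕ.* (t ℕ.* t)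
    ≡⟨ ℕS.solve 3 (λ a s t → a ℕS.:* (s ℕS.:* s) ℕS.:* (t ℕS.:* t) ℕS.:= a ℕS.:* (t ℕS.:* t) ℕS.:* (s ℕS.:* s)) refl a s t ⟩
  a ℕ.* (t ℕ.* t) ℕ.* (s ℕ.* s)
    <⟨ ℕ.*-monoˡ-< (s ℕ.* s) {{ℕ.m*n≢0 s s}} (√-upper t q) ⟩
  j ℕ.* j ℕ.* d ℕ.* (s ℕ.* s)
    ≡⟨ ℕS.solve 3 (λ j s d → j ℕS.:* j ℕS.:* d ℕS.:* (s ℕS.:* s) ℕS.:= (j ℕS.:* s) ℕS.:* (j ℕS.:* s) ℕS.:* d) refl j s d ⟩
  (j ℕ.* s) ℕ.* (j ℕ.* s) ℕ.* d ∎))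
  where
  open ℕ.≤-Reasoning
  a = ℤ.∣ ↥ q ∣
  d = ↧ₙ q
  i = ⌊ s √ q ⌋
  j = suc ⌊ t √ q ⌋

suc-/ : ∀ a b .{{_ : ℕ.NonZero b}} → (+ suc a) / b ≡ (+ a) / b ℚ.+ (+ 1) / b
suc-/ a b@(suc k) = ℚ.toℚᵘ-injective (begin-equality
  ℚ.toℚᵘ ((+ suc a) / b)                     ≃⟨ ℚ.toℚᵘ-fromℚᵘ ((+ suc a) ℚᵘ./ b) ⟩
  (+ suc a) ℚᵘ./ b                           ≃⟨ ℚᵘ.*≡* eq ⟩
  (+ a) ℚᵘ./ b ℚᵘ.+ (+ 1) ℚᵘ./ b             ≃⟨ ℚᵘ.+-cong (ℚ.toℚᵘ-fromℚᵘ ((+ a) ℚᵘ./ b)) (ℚ.toℚᵘ-fromℚᵘ ((+ 1) ℚᵘ./ b)) ⟨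
  ℚ.toℚᵘ ((+ a) / b) ℚᵘ.+ ℚ.toℚᵘ ((+ 1) / b) ≃⟨ ℚ.toℚᵘ-homo-+ ((+ a) / b) ((+ 1) / b) ⟨
  ℚ.toℚᵘ ((+ a) / b ℚ.+ (+ 1) / b)           ∎)
  where
  open ℚᵘ.≤-Reasoning
  eq : + suc a ℤ.* + (b ℕ.* b) ≡ (+ a ℤ.* + b ℤ.+ + 1 ℤ.* + b) ℤ.* + b
  eq = trans (sym (ℤ.pos-* (suc a) (b ℕ.* b)))
    (trans (cong +_ (ℕS.solve 2 (λ a b → (ℕS.con 1 ℕS.:+ a) ℕS.:* (b ℕS.:* b) ℕS.:= (a ℕS.:* b ℕS.:+ ℕS.con 1 ℕS.:* b) ℕS.:* b) refl a b))
    (trans (ℤ.pos-* (a ℕ.* b ℕ.+ 1 ℕ.* b) b)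
      (cong (ℤ._* + b) (cong₂ ℤ._+_ (ℤ.pos-* a b) (ℤ.pos-* 1 b)))))

√ : (q : ℚ) → .{{ℚ.NonNegative q}} → ℝ
approx (√ q) k = (+ ⌊ suc k √ q ⌋) / suc k
cauchy (√ q) = rate⇒cauchy λ m n →
  subst ((+ ⌊ suc m √ q ⌋) / suc m ℚ.≤_) (suc-/ ⌊ suc n √ q ⌋ (suc n))
    (/-≤ ⌊ suc m √ q ⌋ (suc m) (suc ⌊ suc n √ q ⌋) (suc n)
      (ℕ.<⇒≤ (√-cross (suc m) (suc n) q)))

2^ℤ : ℤ → ℚ
2^ℤ (+ k)    = (+ (2 ℕ.^ k)) / 1
2^ℤ -[1+ k ] = ((+ 1) / (2 ℕ.^ suc k)) {{ℕ.m^n≢0 2 (suc k)}}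

2^ℤ-nonNeg : ∀ a → ℚ.NonNegative (2^ℤ a)
2^ℤ-nonNeg (+ k)    = ℚ.normalize-nonNeg (2 ℕ.^ k) 1
2^ℤ-nonNeg -[1+ k ] = ℚ.normalize-nonNeg 1 (2 ℕ.^ suc k) {{ℕ.m^n≢0 2 (suc k)}}

-- 2^(a/2), read as √(2^a)
2^[_/2] : ℤ → ℝ
2^[ a /2] = √ (2^ℤ a) {{2^ℤ-nonNeg a}}

Σ< : ℕ → (ℕ → ℚ) → ℚ
Σ< zero    f = 0ℚ
Σ< (suc n) f = Σ< n f ℚ.+ f n

Σ<-mono : ∀ n {f g} → (∀ i → i ℕ.< n → f i ℚ.≤ g i) → Σ< n f ℚ.≤ Σ< n g
Σ<-mono zero    h = ℚ.≤-refl
Σ<-mono (suc n) h =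
  ℚ.+-mono-≤ (Σ<-mono n (λ i i<n → h i (ℕ.m<n⇒m<1+n i<n))) (h n (ℕ.n<1+n n))

Σ<-cong : ∀ n {f g} → (∀ i → f i ≡ g i) → Σ< n f ≡ Σ< n g
Σ<-cong zero    h = refl
Σ<-cong (suc n) h = cong₂ ℚ._+_ (Σ<-cong n h) (h n)

Σ<-const : ∀ n b .{{_ : ℕ.NonZero b}} → Σ< n (λ _ → (+ 1) / b) ≡ (+ n) / b
Σ<-const zero    b = sym (ℚ.0/n≡0 b)
Σ<-const (suc n) b = trans (cong (ℚ._+ (+ 1) / b) (Σ<-const n b)) (sym (suc-/ n b))

Σ<-telescope : ∀ n f → Σ< n f ℚ.+ f n ≡ Σ< n (λ i → f (suc i)) ℚ.+ f 0
Σ<-telescope zero    f = refl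
Σ<-telescope (suc n) f = begin
  Σ< n f ℚ.+ f n ℚ.+ f (suc n)
    ≡⟨ cong (ℚ._+ f (suc n)) (Σ<-telescope n f) ⟩
  Σ< n (λ i → f (suc i)) ℚ.+ f 0 ℚ.+ f (suc n)
    ≡⟨ ℚS.solve 3 (λ a b c → a ℚS.:+ b ℚS.:+ c ℚS.:= a ℚS.:+ c ℚS.:+ b) refl (Σ< n (λ i → f (suc i))) (f 0) (f (suc n)) ⟩
  Σ< n (λ i → f (suc i)) ℚ.+ f (suc n) ℚ.+ f 0 ∎
  where open ≡-Reasoning

Σ<-+ : ∀ m n f → Σ< (m ℕ.+ n) f ≡ Σ< m f ℚ.+ Σ< n (λ k → f (m ℕ.+ k))
Σ<-+ m zero    f = trans (cong (λ k → Σ< k f) (ℕ.+-identityʳ m)) (sym (ℚ.+-identityʳ (Σ< m f)))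
Σ<-+ m (suc n) f = begin
  Σ< (m ℕ.+ suc n) f
    ≡⟨ cong (λ k → Σ< k f) (ℕ.+-suc m n) ⟩
  Σ< (m ℕ.+ n) f ℚ.+ f (m ℕ.+ n)
    ≡⟨ cong (ℚ._+ f (m ℕ.+ n)) (Σ<-+ m n f) ⟩
  Σ< m f ℚ.+ Σ< n (λ k → f (m ℕ.+ k)) ℚ.+ f (m ℕ.+ n)
    ≡⟨ ℚ.+-assoc (Σ< m f) (Σ< n (λ k → f (m ℕ.+ k))) (f (m ℕ.+ n)) ⟩
  Σ< m f ℚ.+ (Σ< n (λ k → f (m ℕ.+ k)) ℚ.+ f (m ℕ.+ n)) ∎
  where open ≡-Reasoning

Σ<-* : ∀ n t f → Σ< (n ℕ.* t) f ≡ Σ< n (λ i → Σ< t (λ k → f (i ℕ.* t ℕ.+ k)))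
Σ<-* zero    t f = refl
Σ<-* (suc n) t f = begin
  Σ< (t ℕ.+ n ℕ.* t) f
    ≡⟨ cong (λ k → Σ< k f) (ℕ.+-comm t (n ℕ.* t)) ⟩
  Σ< (n ℕ.* t ℕ.+ t) f
    ≡⟨ Σ<-+ (n ℕ.* t) t f ⟩
  Σ< (n ℕ.* t) f ℚ.+ Σ< t (λ k → f (n ℕ.* t ℕ.+ k))
    ≡⟨ cong (ℚ._+ Σ< t (λ k → f (n ℕ.* t ℕ.+ k))) (Σ<-* n t f) ⟩
  Σ< n (λ i → Σ< t (λ k → f (i ℕ.* t ℕ.+ k))) ℚ.+ Σ< t (λ k → f (n ℕ.* t ℕ.+ k)) ∎
  where open ≡-Reasoning

-- The right Riemann sum of ∫₁^(1+w) dt/t with mesh 1/N, which is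
-- 1/(N+1) + 1/(N+2) + ⋯ + 1/((1+w)N).
logSum : (w N : ℕ) → ℚ
logSum w N = Σ< (w ℕ.* N) (λ j → (+ 1) / suc (N ℕ.+ j))

-- the left Riemann sum with mesh 1/(n+1)
logSumˡ : (w n : ℕ) → ℚ
logSumˡ w n = Σ< (w ℕ.* suc n) (λ j → (+ 1) / suc (n ℕ.+ j))

logSum-refine : ∀ w t s .{{_ : ℕ.NonZero s}} → logSum w t ℚ.≤ logSum w (t ℕ.* s)
logSum-refine w t s = begin
  Σ< (w ℕ.* t) (λ i → (+ 1) / suc (t ℕ.+ i))
    ≤⟨ Σ<-mono (w ℕ.* t) (λ i _ → block i) ⟩
  Σ< (w ℕ.* t) (λ i → Σ< s (λ k → f (i ℕ.* s ℕ.+ k)))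
    ≡⟨ Σ<-* (w ℕ.* t) s f ⟨
  Σ< (w ℕ.* t ℕ.* s) f
    ≡⟨ cong (λ k → Σ< k f) (ℕ.*-assoc w t s) ⟩
  Σ< (w ℕ.* (t ℕ.* s)) f ∎
  where
  open ℚ.≤-Reasoning
  f : ℕ → ℚ
  f j = (+ 1) / suc (t ℕ.* s ℕ.+ j)
  block : ∀ i → (+ 1) / suc (t ℕ.+ i) ℚ.≤ Σ< s (λ k → f (i ℕ.* s ℕ.+ k))
  block i = begin
    (+ 1) / suc (t ℕ.+ i)
      ≤⟨ /-≤ 1 (suc (t ℕ.+ i)) s c (ℕ.≤-reflexive (trans (ℕ.*-identityˡ c) (ℕ.*-comm (suc (t ℕ.+ i)) s))) ⟩
    (+ s) / c
      ≡⟨ Σ<-const s c ⟨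
    Σ< s (λ _ → (+ 1) / c)
      ≤⟨ Σ<-mono s (λ k k<s → /-≤ 1 c 1 (suc (t ℕ.* s ℕ.+ (i ℕ.* s ℕ.+ k))) (ℕ.*-monoʳ-≤ 1 (le k k<s))) ⟩
    Σ< s (λ k → f (i ℕ.* s ℕ.+ k)) ∎
    where
    c = suc (t ℕ.+ i) ℕ.* s
    instance
      _ = ℕ.m*n≢0 (suc (t ℕ.+ i)) s
    le : ∀ k → k ℕ.< s → suc (t ℕ.* s ℕ.+ (i ℕ.* s ℕ.+ k)) ℕ.≤ c
    le k k<s = ℕ.≤-trans
      (ℕ.≤-reflexive (ℕS.solve 4 (λ t i s k → ℕS.con 1 ℕS.:+ (t ℕS.:* s ℕS.:+ (i ℕS.:* s ℕS.:+ k)) ℕS.:= (ℕS.con 1 ℕS.:+ k) ℕS.:+ (t ℕS.:+ i) ℕS.:* s) refl t i s k))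
      (ℕ.+-monoˡ-≤ ((t ℕ.+ i) ℕ.* s) k<s)

logSumˡ-refine : ∀ w n m → logSumˡ w (m ℕ.+ n ℕ.* suc m) ℚ.≤ logSumˡ w n
logSumˡ-refine w n m = begin
  Σ< (w ℕ.* (suc n ℕ.* s)) f
    ≡⟨ cong (λ k → Σ< k f) (ℕ.*-assoc w (suc n) s) ⟨
  Σ< (w ℕ.* suc n ℕ.* s) f
    ≡⟨ Σ<-* (w ℕ.* suc n) s f ⟩
  Σ< (w ℕ.* suc n) (λ i → Σ< s (λ k → f (i ℕ.* s ℕ.+ k)))
    ≤⟨ Σ<-mono (w ℕ.* suc n) (λ i _ → block i) ⟩
  Σ< (w ℕ.* suc n) (λ i → (+ 1) / suc (n ℕ.+ i)) ∎
  where
  open ℚ.≤-Reasoning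
  s = suc m
  f : ℕ → ℚ
  f j = (+ 1) / suc (m ℕ.+ n ℕ.* s ℕ.+ j)
  block : ∀ i → Σ< s (λ k → f (i ℕ.* s ℕ.+ k)) ℚ.≤ (+ 1) / suc (n ℕ.+ i)
  block i = begin
    Σ< s (λ k → f (i ℕ.* s ℕ.+ k))
      ≤⟨ Σ<-mono s (λ k _ → /-≤ 1 (suc (m ℕ.+ n ℕ.* s ℕ.+ (i ℕ.* s ℕ.+ k))) 1 c (ℕ.*-monoʳ-≤ 1 (le k))) ⟩
    Σ< s (λ _ → (+ 1) / c)
      ≡⟨ Σ<-const s c ⟩
    (+ s) / c
      ≤⟨ /-≤ s c 1 (suc (n ℕ.+ i)) (ℕ.≤-reflexive (trans (ℕ.*-comm s (suc (n ℕ.+ i))) (sym (ℕ.*-identityˡ c)))) ⟩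
    (+ 1) / suc (n ℕ.+ i) ∎
    where
    c = suc (n ℕ.+ i) ℕ.* s
    le : ∀ k → c ℕ.≤ suc (m ℕ.+ n ℕ.* s ℕ.+ (i ℕ.* s ℕ.+ k))
    le k = ℕ.≤-trans (ℕ.m≤m+n c k)
      (ℕ.≤-reflexive (ℕS.solve 4 (λ n i m k → (ℕS.con 1 ℕS.:+ (n ℕS.:+ i)) ℕS.:* (ℕS.con 1 ℕS.:+ m) ℕS.:+ k ℕS.:= ℕS.con 1 ℕS.:+ (m ℕS.:+ n ℕS.:* (ℕS.con 1 ℕS.:+ m) ℕS.:+ (i ℕS.:* (ℕS.con 1 ℕS.:+ m) ℕS.:+ k))) refl n i m k))

logSum≤logSumˡ : ∀ w n → logSum w (suc n) ℚ.≤ logSumˡ w n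
logSum≤logSumˡ w n = Σ<-mono (w ℕ.* suc n) λ j _ →
  /-≤ 1 (suc (suc (n ℕ.+ j))) 1 (suc (n ℕ.+ j)) (ℕ.*-monoʳ-≤ 1 (ℕ.n≤1+n (suc (n ℕ.+ j))))

logSumˡ≤logSum : ∀ w n → logSumˡ w n ℚ.≤ logSum w (suc n) ℚ.+ (+ 1) / suc n
logSumˡ≤logSum w n = begin
  Σ< l f
    ≡⟨ ℚ.+-identityʳ (Σ< l f) ⟨
  Σ< l f ℚ.+ 0ℚ
    ≤⟨ ℚ.+-monoʳ-≤ (Σ< l f) (ℚ.nonNegative⁻¹ (f l) {{ℚ.normalize-nonNeg 1 (suc (n ℕ.+ l))}}) ⟩
  Σ< l f ℚ.+ f l
    ≡⟨ Σ<-telescope l f ⟩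
  Σ< l (λ j → f (suc j)) ℚ.+ f 0
    ≡⟨ cong₂ ℚ._+_ (Σ<-cong l (λ j → cong (λ k → (+ 1) / suc k) (ℕ.+-suc n j)))
                   (cong (λ k → (+ 1) / suc k) (ℕ.+-identityʳ n)) ⟩
  logSum w (suc n) ℚ.+ (+ 1) / suc n ∎
  where
  open ℚ.≤-Reasoning
  l = w ℕ.* suc n
  f : ℕ → ℚ
  f j = (+ 1) / suc (n ℕ.+ j)

-- log v = ∫₁^v dt/t for v ≥ 1; the value at v = 0 is the junk value 0.
log : ℕ → ℝ
approx (log v) k = logSum (v ℕ.∸ 1) (suc k)
cauchy (log v) = rate⇒cauchy λ m n → begin
  logSum w (suc m)
    ≤⟨ logSum-refine w (suc m) (suc n) ⟩
  logSum w (suc m ℕ.* suc n)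
    ≡⟨ cong (logSum w) (ℕ.*-comm (suc m) (suc n)) ⟩
  logSum w (suc n ℕ.* suc m)
    ≤⟨ logSum≤logSumˡ w (m ℕ.+ n ℕ.* suc m) ⟩
  logSumˡ w (m ℕ.+ n ℕ.* suc m)
    ≤⟨ logSumˡ-refine w n m ⟩
  logSumˡ w n
    ≤⟨ logSumˡ≤logSum w n ⟩
  logSum w (suc n) ℚ.+ (+ 1) / suc n ∎
  where
  open ℚ.≤-Reasoning
  w = v ℕ.∸ 1

{-# OPTIONS --safe #-}

-- Let M = 2ⁿ and D = M - 1.  Join k ≈ (n - 1) log v / log (M / D) hubs to all
-- vertices by fair coin flips.  A partition (A , B) of an n-set S without hubs
-- is realised by no hub with probability (D / M)ᵏ ≈ v¹⁻ⁿ, so on average only a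
-- small multiple of v partitions fail.  Each of these is repaired by joining
-- its A to a fresh vertex outside all failing sets; edges between non-hubs do
-- not change what the hubs realise.  The S that meet the hubs are fewer by a
-- factor of about v / k, so slightly more hubs realise all their partitions.
-- The method of conditional expectations makes the coin flips deterministic.
-- There are about k v / 2 ≤ (n - 1) 2ⁿ⁻¹ v log v edges, as log (M / D) ≥ 1 / M,
-- and the summand 2^((3-n)/2) ≥ 1 / M absorbs the lower order terms: o = 0.
module Submission where

open import Data.Nat.Tactic.RingSolver using (solve-∀)
open import Data.Product.Base using (∃; _×_; _,_; proj₁; proj₂)
open import Data.Sum.Base using (_⊎_; inj₁; inj₂)
open import Relation.Binary.PropositionalEquality
open import Relation.Nullary.Decidable
  using (Dec; yes; no; does; dec-true; dec-false; _×-dec_; _⊎-dec_; _→-dec_; ¬?; decidable-stable)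
open import Relation.Nullary.Negation using (¬_; contradiction)
open import Relation.Unary using (Pred; Decidable)

-- Every estimate is an inequality of integers: a probability of failing at all `k` hubs is scaled
-- by `M ^ k`, and `log v` is compared with `L * log (M / D)` only through `M ^ L ≤ v * D ^ L`. The
-- weights that force all events at once cost a factor quadratic in `k`, hence polylogarithmic in
-- `v`. Any fixed proportion of surplus hubs beats it, because `3 * x` more hubs gain a factor
-- `(M / D) ^ (3 * x)`, exponential in `x`. The surplus is limited by the target: a coefficient
-- `1 + 1 / M` allows `(n - 1) * L / M` hubs beyond `(n - 1) * L`, which is at least `2 * L / M` for
-- `n ≥ 3`. One share of `L / M` pays for the surplus hubs. The other pays for rounding and for the
-- `3` in `2 * e ≤ (k + 3) * v`: one `v` there is the margin of the derandomisation and two are the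
-- repairs.

module Graphs where

  open import Defs using (Graph; edgeCount; IsExistentiallyClosed; IsMinEdgeCount)
  open import Data.Bool.Base using (Bool; true; false; not; if_then_else_)
  import Data.Bool.Properties as Bool
  open import Data.Fin.Base as Fin using (Fin; toℕ; fromℕ<; combine; remQuot)
  open import Data.Fin.Properties as Fin using (toℕ-fromℕ<; toℕ<n; toℕ-injective; remQuot-combine)
  open import Data.Fin.Subset as Subset using (Subset; _∪_; _∩_; ⊥) renaming (∣_∣ to card)
  open import Data.Fin.Subset.Properties as Subset using (anySubset?; x∈p∪q⁻)
  open import Data.List.Base
    using (List; []; _∷_; _++_; length; map; filter; cartesianProduct; upTo; concatMap; zip; allFin)
  open import Data.List.Membership.Propositional using (_∈_; _∉_)
  open import Data.List.Membership.Propositional.Properties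
  open import Data.List.Properties
    using (length-++; length-++-sucʳ; length-map; length-filter; length-upTo; filter-≐)
  open import Data.List.Relation.Binary.Subset.Propositional using (_⊆_)
  open import Data.List.Relation.Unary.All as All using (All; []; _∷_)
  open import Data.List.Relation.Unary.AllPairs using ([]; _∷_)
  open import Data.List.Relation.Unary.Any using (here; there)
  open import Data.List.Relation.Unary.Unique.Propositional using (Unique)
  import Data.List.Relation.Unary.Unique.Propositional.Properties as Unique
  open import Data.Maybe.Base using (Maybe; just; nothing)
  open import Data.Maybe.Properties using (≡-dec)
  open import Data.Nat.Base
  open import Data.Nat.ListAction using (sum)
  open import Data.Nat.Properties
  open import Data.List.Membership.DecPropositional _≟_ using (_∈?_)
  import Data.Product.Properties as Product
  import Data.Vec.Base as Vec
  import Data.Vec.Properties as Vec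
  open import Function.Base using (_∘_; case_of_)

  unique∧⊆⇒length≤ : ∀ {a} {A : Set a} {xs ys : List A} → Unique xs → xs ⊆ ys → length xs ≤ length ys
  unique∧⊆⇒length≤ {xs = []} _ _ = z≤n
  unique∧⊆⇒length≤ {xs = x ∷ xs} (x∉xs ∷ u) xs⊆ys with ∈-∃++ (xs⊆ys (here refl))
  ... | as , bs , refl =
    ≤-trans (s≤s (unique∧⊆⇒length≤ u sub)) (≤-reflexive (sym (length-++-sucʳ as x bs)))
    where
    sub : xs ⊆ (as ++ bs)
    sub {y} y∈xs with ∈-++⁻ as (xs⊆ys (there y∈xs))
    ... | inj₁ y∈as         = ∈-++⁺ˡ y∈as
    ... | inj₂ (here refl)  = contradiction refl (All.lookup x∉xs y∈xs)
    ... | inj₂ (there y∈bs) = ∈-++⁺ʳ as y∈bs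

  -- Conditional failure probabilities under partially decided coins.

  Assignment : Set
  Assignment = ℕ → ℕ → Maybe Bool

  assign : Assignment → ℕ → ℕ → Bool → Assignment
  assign w i j b x y = if does (x ≟ i ×-dec y ≟ j) then just b else w x y

  -- Twice the conditional probability that a pair has status b.
  weight : Bool → Maybe Bool → ℕ
  weight b     nothing      = 1
  weight true  (just true)  = 2
  weight true  (just false) = 0
  weight false (just true)  = 0
  weight false (just false) = 2

  -- A coin belongs to an unordered pair and is stored once, at its ordered representative.
  _⟨_,_⟩ : Assignment → ℕ → ℕ → Maybe Bool
  w ⟨ x , y ⟩ = w (x ⊓ y) (x ⊔ y)

  -- A set with a partition: (s , true) puts s in A, and (s , false) puts it in B.
  Pattern : Set
  Pattern = List (ℕ × Bool)

  vertices : Pattern → List ℕ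
  vertices = map proj₁

  -- 2^|S| times the conditional probability that z does not realise S; the
  -- recursion is 1 - p q = (1 - p) + p (1 - q).
  miss : Assignment → ℕ → Pattern → ℕ
  miss w z []            = 0
  miss w z ((s , b) ∷ S) =
    weight (not b) (w ⟨ z , s ⟩) * 2 ^ length S + weight b (w ⟨ z , s ⟩) * miss w z S

  -- A vertex of `S` never counts as a witness for `S`, so it fails with probability 1; thereby no
  -- coin of a loop is ever consulted.
  factor : Assignment → Pattern → ℕ → ℕ
  factor w S z = if does (z ∈? vertices S) then 2 ^ length S else miss w z S

  ∏ : ℕ → (ℕ → ℕ) → ℕ
  ∏ zero    f = 1
  ∏ (suc k) f = ∏ k f * f k

  ∏-cong : ∀ k {f g} → (∀ z → z < k → f z ≡ g z) → ∏ k f ≡ ∏ k g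
  ∏-cong zero    h = refl
  ∏-cong (suc k) h = cong₂ _*_ (∏-cong k (λ z z<k → h z (m<n⇒m<1+n z<k))) (h k ≤-refl)

  ∏-const : ∀ k c → ∏ k (λ _ → c) ≡ c ^ k
  ∏-const zero    c = refl
  ∏-const (suc k) c = trans (cong (_* c) (∏-const k c)) (*-comm (c ^ k) c)

  -- The conditional probability that no hub realises `S`, times `(2 ^ length S) ^ k`: different
  -- hubs use disjoint sets of coins, so their failures are independent.
  failure : ℕ → Assignment → Pattern → ℕ
  failure k w S = ∏ k (factor w S)

  +-interchange : ∀ a b c d → (a + b) + (c + d) ≡ (a + c) + (b + d)
  +-interchange = solve-∀

  -- Deciding one pair fairly leaves the expectation of an affine f unchanged.
  module _ (w : Assignment) (i j : ℕ) where

    Affine Constant : (Assignment → ℕ) → Set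
    Affine f = f (assign w i j true) + f (assign w i j false) ≡ f w + f w
    Constant f = ∀ b → f (assign w i j b) ≡ f w

    constant⇒affine : ∀ {f} → Constant f → Affine f
    constant⇒affine c = cong₂ _+_ (c true) (c false)

    +-affine : ∀ {f g} → Affine f → Affine g → Affine (λ v → f v + g v)
    +-affine {f} {g} p q = begin
      (f wt + g wt) + (f wf + g wf) ≡⟨ +-interchange (f wt) (g wt) (f wf) (g wf) ⟩
      (f wt + f wf) + (g wt + g wf) ≡⟨ cong₂ _+_ p q ⟩
      (f w + f w) + (g w + g w)     ≡⟨ +-interchange (f w) (f w) (g w) (g w) ⟩
      (f w + g w) + (f w + g w)     ∎
      where
      open ≡-Reasoning
      wt wf : Assignment
      wt = assign w i j true
      wf = assign w i j false

    -- A product of two factors that both depend on the coin is quadratic in it. All products below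
    -- are therefore shown to have at most one factor that depends on a given coin.
    *-affineˡ : ∀ {f g} → Affine f → Constant g → Affine (λ v → f v * g v)
    *-affineˡ {f} {g} p c = begin
      f wt * g wt + f wf * g wf ≡⟨ cong₂ (λ a b → f wt * a + f wf * b) (c true) (c false) ⟩
      f wt * g w + f wf * g w   ≡⟨ *-distribʳ-+ (g w) (f wt) (f wf) ⟨
      (f wt + f wf) * g w       ≡⟨ cong (_* g w) p ⟩
      (f w + f w) * g w         ≡⟨ *-distribʳ-+ (g w) (f w) (f w) ⟩
      f w * g w + f w * g w     ∎
      where
      open ≡-Reasoning
      wt wf : Assignment
      wt = assign w i j true
      wf = assign w i j false

    *-affineʳ : ∀ {f g} → Constant f → Affine g → Affine (λ v → f v * g v)
    *-affineʳ {f} {g} c p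
      rewrite *-comm (f (assign w i j true)) (g (assign w i j true))
            | *-comm (f (assign w i j false)) (g (assign w i j false))
            | *-comm (f w) (g w) = *-affineˡ {g} {f} p c

    sum-affine : ∀ {a} {A : Set a} (f : Assignment → A → ℕ) xs →
                 (∀ {x} → x ∈ xs → Affine (λ v → f v x)) → Affine (λ v → sum (map (f v) xs))
    sum-affine f []       h = refl
    sum-affine f (x ∷ xs) h =
      +-affine {λ v → f v x} {λ v → sum (map (f v) xs)} (h (here refl)) (sum-affine f xs (h ∘ there))

    ∏-constant : ∀ k (f : Assignment → ℕ → ℕ) → (∀ z → z < k → Constant (λ v → f v z)) →
                 Constant (λ v → ∏ k (f v))
    ∏-constant k f h b = ∏-cong k (λ z z<k → h z z<k b)

    ∏-affine : ∀ k z₀ (f : Assignment → ℕ → ℕ) → (∀ z → Affine (λ v → f v z)) →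
               (∀ z → z ≢ z₀ → Constant (λ v → f v z)) → Affine (λ v → ∏ k (f v))
    ∏-affine zero    z₀ f aff con = refl
    ∏-affine (suc k) z₀ f aff con with k ≟ z₀
    ... | yes refl = *-affineʳ {λ v → ∏ k (f v)} {λ v → f v k}
                       (∏-constant k f (λ z z<k → con z (<⇒≢ z<k))) (aff k)
    ... | no k≢z₀  = *-affineˡ {λ v → ∏ k (f v)} {λ v → f v k}
                       (∏-affine k z₀ f aff con) (con k k≢z₀)

    pair-constant : ∀ {x y} → (x , y) ≢ (i , j) → ∀ b → assign w i j b x y ≡ w x y
    pair-constant {x} {y} ne b = cong (if_then just b else w x y)
      (dec-false (x ≟ i ×-dec y ≟ j) λ { (refl , refl) → ne refl })

    pair-assigned : ∀ b → assign w i j b i j ≡ just b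
    pair-assigned b = cong (if_then just b else w i j)
      (dec-true (i ≟ i ×-dec j ≟ j) (refl , refl))

    assign-set : ∀ b {x y} → ∃ (λ c → w x y ≡ just c) → ∃ (λ c → assign w i j b x y ≡ just c)
    assign-set b {x} {y} (c , e) with x ≟ i ×-dec y ≟ j
    ... | yes (refl , refl) = b , pair-assigned b
    ... | no ne             = c , trans (pair-constant (λ { refl → ne (refl , refl) }) b) e

    weight-constant : ∀ {x y} b → (x , y) ≢ (i , j) → Constant (λ v → weight b (v x y))
    weight-constant b ne c = cong (weight b) (pair-constant ne c)

    module _ (unset : w i j ≡ nothing) where

      weight-affine : ∀ b x y → Affine (λ v → weight b (v x y))
      weight-affine b x y with x ≟ i ×-dec y ≟ j
      ... | no ne = constant⇒affine {λ v → weight b (v x y)}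
                      (weight-constant b λ { refl → ne (refl , refl) })
      ... | yes (refl , refl) = trans
        (cong₂ (λ s t → weight b s + weight b t) (pair-assigned true) (pair-assigned false))
        (trans (fair b) (cong (λ s → weight b s + weight b s) (sym unset)))
        where
        fair : ∀ b → weight b (just true) + weight b (just false) ≡ 2
        fair true  = refl
        fair false = refl

      miss-constant : ∀ z S → (∀ {s} → s ∈ vertices S → (z ⊓ s , z ⊔ s) ≢ (i , j)) →
                      Constant (λ v → miss v z S)
      miss-constant z []            ne c = refl
      miss-constant z ((s , b) ∷ S) ne c = cong₂ _+_
        (cong (_* 2 ^ length S) (weight-constant (not b) (ne (here refl)) c))
        (cong₂ _*_ (weight-constant b (ne (here refl)) c) (miss-constant z S (ne ∘ there) c))

      pair-injective : ∀ z {s t} → (z ⊓ s , z ⊔ s) ≡ (z ⊓ t , z ⊔ t) → s ≡ t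
      pair-injective z {s} {t} e = +-cancelˡ-≡ z s t
        (trans (sym (⊓+⊔ z s)) (trans (cong (λ (a , b) → a + b) e) (⊓+⊔ z t)))
        where
        ⊓+⊔ : ∀ a b → a ⊓ b + (a ⊔ b) ≡ a + b
        ⊓+⊔ a b with ≤-total a b
        ... | inj₁ a≤b rewrite m≤n⇒m⊓n≡m a≤b | m≤n⇒m⊔n≡n a≤b = refl
        ... | inj₂ b≤a rewrite m≥n⇒m⊓n≡n b≤a | m≥n⇒m⊔n≡m b≤a = +-comm b a

      -- The coin enters the head of the recursion or its tail, never both: for fixed `z` the pair
      -- `{z , s}` determines `s`, and the vertices of `S` are distinct.
      miss-affine : ∀ z S → Unique (vertices S) → Affine (λ v → miss v z S)
      miss-affine z []            u = refl
      miss-affine z ((s , b) ∷ S) (s∉S ∷ u) with z ⊓ s ≟ i ×-dec z ⊔ s ≟ j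
      ... | yes (e₁ , e₂) =
        +-affine {λ v → weight (not b) (v ⟨ z , s ⟩) * 2 ^ length S} {λ v → weight b (v ⟨ z , s ⟩) * miss v z S}
          (*-affineˡ {λ v → weight (not b) (v ⟨ z , s ⟩)} {λ _ → 2 ^ length S}
            (weight-affine (not b) (z ⊓ s) (z ⊔ s)) (λ _ → refl))
          (*-affineˡ {λ v → weight b (v ⟨ z , s ⟩)} {λ v → miss v z S}
            (weight-affine b (z ⊓ s) (z ⊔ s))
            (miss-constant z S λ t∈S e → All.lookup s∉S t∈S
              (pair-injective z (trans (cong₂ _,_ e₁ e₂) (sym e)))))
      ... | no ne =
        +-affine {λ v → weight (not b) (v ⟨ z , s ⟩) * 2 ^ length S} {λ v → weight b (v ⟨ z , s ⟩) * miss v z S}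
          (*-affineˡ {λ v → weight (not b) (v ⟨ z , s ⟩)} {λ _ → 2 ^ length S}
            (weight-affine (not b) (z ⊓ s) (z ⊔ s)) (λ _ → refl))
          (*-affineʳ {λ v → weight b (v ⟨ z , s ⟩)} {λ v → miss v z S}
            (weight-constant b λ { refl → ne (refl , refl) }) (miss-affine z S u))

      factor-affine : ∀ S → Unique (vertices S) → ∀ z → Affine (λ v → factor v S z)
      factor-affine S u z with does (z ∈? vertices S)
      ... | true  = refl
      ... | false = miss-affine z S u

      factor-constant : ∀ S z → (∀ {s} → z ∉ vertices S → s ∈ vertices S → (z ⊓ s , z ⊔ s) ≢ (i , j)) →
                        Constant (λ v → factor v S z)
      factor-constant S z ne c with z ∈? vertices S
      ... | yes _  = refl
      ... | no z∉S = miss-constant z S (ne z∉S) c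

      -- A pair {z , s} with z ∉ S and s ∈ S determines z, so at most one factor depends on it.
      failure-affine : ∀ k S → Unique (vertices S) → Affine (λ v → failure k v S)
      failure-affine k S u with i ∈? vertices S
      ... | yes i∈S = ∏-affine k j (λ v → factor v S) (factor-affine S u)
                        λ z z≢j → factor-constant S z (other z z≢j)
        where
        other : ∀ z → z ≢ j → ∀ {s} → z ∉ vertices S → s ∈ vertices S → (z ⊓ s , z ⊔ s) ≢ (i , j)
        other z z≢j {s} z∉S s∈S e with ≤-total z s
        ... | inj₁ z≤s = z∉S (subst (_∈ vertices S) (trans (sym (cong proj₁ e)) (m≤n⇒m⊓n≡m z≤s)) i∈S)
        ... | inj₂ s≤z = z≢j (trans (sym (m≥n⇒m⊔n≡m s≤z)) (cong proj₂ e))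
      ... | no i∉S = ∏-affine k i (λ v → factor v S) (factor-affine S u)
                       λ z z≢i → factor-constant S z (other z z≢i)
        where
        other : ∀ z → z ≢ i → ∀ {s} → z ∉ vertices S → s ∈ vertices S → (z ⊓ s , z ⊔ s) ≢ (i , j)
        other z z≢i {s} z∉S s∈S e with ≤-total z s
        ... | inj₁ z≤s = z≢i (trans (sym (m≤n⇒m⊓n≡m z≤s)) (cong proj₁ e))
        ... | inj₂ s≤z = i∉S (subst (_∈ vertices S) (trans (sym (m≥n⇒m⊓n≡n s≤z)) (cong proj₁ e)) s∈S)

  average : ∀ {a b c} → a + b ≡ c + c → a ≤ c ⊎ b ≤ c
  average {a} {b} {c} e with a ≤? c
  ... | yes a≤c = inj₁ a≤c
  ... | no a≰c  = inj₂ (≮⇒≥ λ c<b → <⇒≢ (+-mono-< (≰⇒> a≰c) c<b) (sym e))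

  -- The values of `F` for the two outcomes of an undecided coin average to the current value, so
  -- one of them does not exceed it. A pair already decided keeps its value, which also covers
  -- repetitions in `es`.
  derandomise : ∀ (F : Assignment → ℕ) → (∀ w i j → w i j ≡ nothing → Affine w i j F) →
                ∀ es w → ∃ λ w′ → F w′ ≤ F w × (∀ {x y} → (x , y) ∈ es → ∃ λ b → w′ x y ≡ just b)
  derandomise F aff []             w = w , ≤-refl , λ ()
  derandomise F aff ((i , j) ∷ es) w with derandomise F aff es w
  ... | w₁ , F≤ , set with w₁ i j in eq
  ...   | just b = w₁ , F≤ , λ { (here refl) → b , eq ; (there e∈es) → set e∈es }
  ...   | nothing with average (aff w₁ i j eq)
  ...     | inj₁ ≤F = assign w₁ i j true , ≤-trans ≤F F≤ , λ
              { (here refl)  → true , pair-assigned w₁ i j true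
              ; (there e∈es) → assign-set w₁ i j true (set e∈es) }
  ...     | inj₂ ≤F = assign w₁ i j false , ≤-trans ≤F F≤ , λ
              { (here refl)  → false , pair-assigned w₁ i j false
              ; (there e∈es) → assign-set w₁ i j false (set e∈es) }

  -- Failure probabilities before any coin is decided.

  unset : Assignment
  unset _ _ = nothing

  -- Of the `2 ^ length S` equally likely outcomes exactly one realises `S`.
  miss-unset : ∀ z S → suc (miss unset z S) ≡ 2 ^ length S
  miss-unset z []      = refl
  miss-unset z (_ ∷ S) = trans (lemma (2 ^ length S) (miss unset z S))
                               (cong (λ m → 2 ^ length S + (m + 0)) (miss-unset z S))
    where
    lemma : ∀ a b → suc (1 * a + 1 * b) ≡ a + (suc b + 0)
    lemma = solve-∀

  factor-∈ : ∀ w S z → z ∈ vertices S → factor w S z ≡ 2 ^ length S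
  factor-∈ w S z z∈S = cong (if_then 2 ^ length S else miss w z S) (dec-true (z ∈? vertices S) z∈S)

  factor-∉ : ∀ w S z → z ∉ vertices S → factor w S z ≡ miss w z S
  factor-∉ w S z z∉S = cong (if_then 2 ^ length S else miss w z S) (dec-false (z ∈? vertices S) z∉S)

  ∏-spike : ∀ k s {f g} → (∀ z → z ≢ s → f z ≡ g z) → f s ≤ 2 * g s → ∏ k f ≤ 2 * ∏ k g
  ∏-spike zero    s f≡g fs≤ = s≤s z≤n
  ∏-spike (suc k) s {f} {g} f≡g fs≤ with k ≟ s
  ... | yes refl = begin
    ∏ k f * f k       ≡⟨ cong (_* f k) (∏-cong k (λ z z<k → f≡g z (<⇒≢ z<k))) ⟩
    ∏ k g * f k       ≤⟨ *-monoʳ-≤ (∏ k g) fs≤ ⟩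
    ∏ k g * (2 * g k) ≡⟨ lemma (∏ k g) (g k) ⟩
    2 * (∏ k g * g k) ∎
    where
    open ≤-Reasoning
    lemma : ∀ a b → a * (2 * b) ≡ 2 * (a * b)
    lemma = solve-∀
  ... | no k≢s = begin
    ∏ k f * f k       ≡⟨ cong (∏ k f *_) (f≡g k k≢s) ⟩
    ∏ k f * g k       ≤⟨ *-monoˡ-≤ (g k) (∏-spike k s f≡g fs≤) ⟩
    2 * ∏ k g * g k   ≡⟨ *-assoc 2 (∏ k g) (g k) ⟩
    2 * (∏ k g * g k) ∎
    where open ≤-Reasoning

  module _ {M D : ℕ} (1+D≡M : suc D ≡ M) (1≤D : 1 ≤ D) where

    private
      cell : List ℕ → ℕ → ℕ
      cell V z = if does (z ∈? V) then M else D

      cell-∈ : ∀ {V z} → z ∈ V → cell V z ≡ M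
      cell-∈ {V} {z} z∈V = cong (if_then M else D) (dec-true (z ∈? V) z∈V)

      cell-∉ : ∀ {V z} → z ∉ V → cell V z ≡ D
      cell-∉ {V} {z} z∉V = cong (if_then M else D) (dec-false (z ∈? V) z∉V)

      M≤2D : M ≤ 2 * D
      M≤2D = ≤-trans (≤-reflexive (sym 1+D≡M)) (+-mono-≤ 1≤D (m≤m+n D 0))

      M≤2cell : ∀ V z → M ≤ 2 * cell V z
      M≤2cell V z with does (z ∈? V)
      ... | true  = m≤m+n M (M + 0)
      ... | false = M≤2D

      cell-bound : ∀ k V → ∏ k (cell V) ≤ 2 ^ length V * D ^ k
      cell-bound k []      = ≤-reflexive (trans (∏-const k D) (sym (*-identityˡ (D ^ k))))
      cell-bound k (s ∷ V) = begin
        ∏ k (cell (s ∷ V))            ≤⟨ ∏-spike k s same (≤-trans (≤-reflexive (cell-∈ {s ∷ V} (here refl)))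
                                                               (M≤2cell V s)) ⟩
        2 * ∏ k (cell V)              ≤⟨ *-monoʳ-≤ 2 (cell-bound k V) ⟩
        2 * (2 ^ length V * D ^ k)    ≡⟨ *-assoc 2 (2 ^ length V) (D ^ k) ⟨
        2 ^ length (s ∷ V) * D ^ k    ∎
        where
        open ≤-Reasoning
        same : ∀ z → z ≢ s → cell (s ∷ V) z ≡ cell V z
        same z z≢s = case z ∈? V of λ where
          (yes z∈V) → trans (cell-∈ {s ∷ V} (there z∈V)) (sym (cell-∈ {V} z∈V))
          (no z∉V)  → trans (cell-∉ {s ∷ V} λ { (here e) → z≢s e ; (there z∈V) → z∉V z∈V }) (sym (cell-∉ {V} z∉V))

      factor-unset : ∀ S → 2 ^ length S ≡ M → ∀ z → factor unset S z ≡ cell (vertices S) z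
      factor-unset S e z with does (z ∈? vertices S)
      ... | true  = e
      ... | false = suc-injective (trans (miss-unset z S) (trans e (sym 1+D≡M)))

    -- A hub inside `S` contributes `M` instead of `D`, a loss of at most a factor 2. There are at
    -- most `length S` such hubs, so `2 ^ length S ≡ M` covers the whole loss.
    failure-unset-≤ : ∀ k S → 2 ^ length S ≡ M → failure k unset S ≤ M * D ^ k
    failure-unset-≤ k S e = begin
      failure k unset S                        ≡⟨ ∏-cong k (λ z _ → factor-unset S e z) ⟩
      ∏ k (cell (vertices S))                  ≤⟨ cell-bound k (vertices S) ⟩
      2 ^ length (vertices S) * D ^ k          ≡⟨ cong (λ l → 2 ^ l * D ^ k) (length-map proj₁ S) ⟩
      2 ^ length S * D ^ k                     ≡⟨ cong (_* D ^ k) e ⟩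
      M * D ^ k                                ∎
      where open ≤-Reasoning

    failure-unset-outside : ∀ k S → 2 ^ length S ≡ M → All (k ≤_) (vertices S) → failure k unset S ≡ D ^ k
    failure-unset-outside k S e k≤S = trans
      (∏-cong k λ z z<k → trans (factor-unset S e z)
        (cell-∉ {vertices S} λ z∈S → <⇒≱ z<k (All.lookup k≤S z∈S)))
      (∏-const k D)

  -- Failure once all coins are decided.

  Realises : Assignment → ℕ → Pattern → Set
  Realises w z S = ∀ s b → (s , b) ∈ S → w ⟨ z , s ⟩ ≡ just b

  miss-decided : ∀ w z S → (∀ {s} → s ∈ vertices S → ∃ λ b → w ⟨ z , s ⟩ ≡ just b) →
                 miss w z S ≡ 2 ^ length S ⊎ Realises w z S
  miss-decided w z []            h = inj₂ λ _ _ ()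
  miss-decided w z ((s , b) ∷ S) h with h (here refl) | miss-decided w z S (h ∘ there)
  miss-decided w z ((s , true)  ∷ S) h | true  , e | inj₁ m rewrite e | m = inj₁ refl
  miss-decided w z ((s , true)  ∷ S) h | false , e | _      rewrite e = inj₁ (+-identityʳ _)
  miss-decided w z ((s , false) ∷ S) h | true  , e | _      rewrite e = inj₁ (+-identityʳ _)
  miss-decided w z ((s , false) ∷ S) h | false , e | inj₁ m rewrite e | m = inj₁ refl
  miss-decided w z ((s , true)  ∷ S) h | true  , e | inj₂ r = inj₂ λ { _ _ (here refl) → e ; t c (there s∈S) → r t c s∈S }
  miss-decided w z ((s , false) ∷ S) h | false , e | inj₂ r = inj₂ λ { _ _ (here refl) → e ; t c (there s∈S) → r t c s∈S }

  -- A decided hub either realises `S` or contributes a full factor `2 ^ length S`. Without a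
  -- realising hub the scaled probability is thus maximal, which turns failure into a decidable
  -- equation of numbers that sums of `failure` can count.
  failure-decided : ∀ k w S → (∀ {z s} → z < k → s ∈ vertices S → z ≢ s → ∃ λ b → w ⟨ z , s ⟩ ≡ just b) →
    failure k w S ≡ (2 ^ length S) ^ k ⊎ ∃ λ z → z < k × z ∉ vertices S × Realises w z S
  failure-decided zero    w S h = inj₁ refl
  failure-decided (suc k) w S h with failure-decided k w S (h ∘ m<n⇒m<1+n)
  ... | inj₂ (z , z<k , r) = inj₂ (z , m<n⇒m<1+n z<k , r)
  ... | inj₁ e = case k ∈? vertices S of λ where
      (yes k∈S) → inj₁ (full (factor-∈ w S k k∈S))
      (no k∉S)  → case miss-decided w k S (λ s∈S → h ≤-refl s∈S λ { refl → k∉S s∈S }) of λ where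
        (inj₁ m) → inj₁ (full (trans (factor-∉ w S k k∉S) m))
        (inj₂ r) → inj₂ (k , ≤-refl , k∉S , r)
    where
    full : factor w S k ≡ 2 ^ length S → failure (suc k) w S ≡ (2 ^ length S) ^ suc k
    full f = trans (cong₂ _*_ e f) (*-comm ((2 ^ length S) ^ k) (2 ^ length S))

  -- Enumerating and counting partitioned sets.

  extend : ℕ → List Pattern → List Pattern
  extend i Ps = map ((i , true) ∷_) Ps ++ map ((i , false) ∷_) Ps

  length-extend : ∀ i Ps → length (extend i Ps) ≡ 2 * length Ps
  length-extend i Ps = begin
    length (extend i Ps) ≡⟨ length-++ (map ((i , true) ∷_) Ps) ⟩
    length (map ((i , true) ∷_) Ps) + length (map ((i , false) ∷_) Ps)
      ≡⟨ cong₂ _+_ (length-map ((i , true) ∷_) Ps) (length-map ((i , false) ∷_) Ps) ⟩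
    length Ps + length Ps ≡⟨ cong (length Ps +_) (+-identityʳ (length Ps)) ⟨
    2 * length Ps        ∎
    where open ≡-Reasoning

  ∈-extend⁺ : ∀ i b {S Ps} → S ∈ Ps → (i , b) ∷ S ∈ extend i Ps
  ∈-extend⁺ i true  S∈ = ∈-++⁺ˡ (∈-map⁺ ((i , true) ∷_) S∈)
  ∈-extend⁺ i false {Ps = Ps} S∈ = ∈-++⁺ʳ (map ((i , true) ∷_) Ps) (∈-map⁺ ((i , false) ∷_) S∈)

  ∈-extend⁻ : ∀ i {S} Ps → S ∈ extend i Ps → ∃ λ b → ∃ λ S′ → S ≡ (i , b) ∷ S′ × S′ ∈ Ps
  ∈-extend⁻ i Ps S∈ with ∈-++⁻ (map ((i , true) ∷_) Ps) S∈
  ... | inj₁ p = let S′ , S′∈ , e = ∈-map⁻ ((i , true) ∷_) p in true , S′ , e , S′∈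
  ... | inj₂ p = let S′ , S′∈ , e = ∈-map⁻ ((i , false) ∷_) p in false , S′ , e , S′∈

  -- patterns i v n has its vertices in the interval [i , i + v), and meeting i h v n
  -- has them in [i , i + h + v), with at least one in [i , i + h).
  patterns : (i v n : ℕ) → List Pattern
  patterns i v       zero    = [] ∷ []
  patterns i zero    (suc n) = []
  patterns i (suc v) (suc n) = patterns (suc i) v (suc n) ++ extend i (patterns (suc i) v n)

  meeting : (i h v n : ℕ) → List Pattern
  meeting i h       v zero    = []
  meeting i zero    v (suc n) = []
  meeting i (suc h) v (suc n) = meeting (suc i) h v (suc n) ++ extend i (patterns (suc i) (h + v) n)

  length-patterns : ∀ i v n → length (patterns i v n) ≤ (2 * v) ^ n
  length-patterns i v       zero    = ≤-refl
  length-patterns i zero    (suc n) = z≤n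
  length-patterns i (suc v) (suc n) = begin
    length (patterns (suc i) v (suc n) ++ extend i (patterns (suc i) v n))
      ≡⟨ length-++ (patterns (suc i) v (suc n)) ⟩
    length (patterns (suc i) v (suc n)) + length (extend i (patterns (suc i) v n))
      ≡⟨ cong (length (patterns (suc i) v (suc n)) +_) (length-extend i (patterns (suc i) v n)) ⟩
    length (patterns (suc i) v (suc n)) + 2 * length (patterns (suc i) v n)
      ≤⟨ +-mono-≤ (length-patterns (suc i) v (suc n)) (*-monoʳ-≤ 2 (length-patterns (suc i) v n)) ⟩
    2 * v * (2 * v) ^ n + 2 * (2 * v) ^ n
      ≡⟨ lemma v ((2 * v) ^ n) ⟩
    2 * suc v * (2 * v) ^ n
      ≤⟨ *-monoʳ-≤ (2 * suc v) (^-monoˡ-≤ n (*-monoʳ-≤ 2 (n≤1+n v))) ⟩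
    (2 * suc v) ^ suc n ∎
    where
    open ≤-Reasoning
    lemma : ∀ a b → 2 * a * b + 2 * b ≡ 2 * suc a * b
    lemma = solve-∀

  length-meeting : ∀ i h v n → length (meeting i h v (suc n)) ≤ h * (2 * (2 * (h + v)) ^ n)
  length-meeting i zero    v n = z≤n
  length-meeting i (suc h) v n = begin
    length (meeting (suc i) h v (suc n) ++ extend i (patterns (suc i) (h + v) n))
      ≡⟨ length-++ (meeting (suc i) h v (suc n)) ⟩
    length (meeting (suc i) h v (suc n)) + length (extend i (patterns (suc i) (h + v) n))
      ≡⟨ cong (length (meeting (suc i) h v (suc n)) +_) (length-extend i (patterns (suc i) (h + v) n)) ⟩
    length (meeting (suc i) h v (suc n)) + 2 * length (patterns (suc i) (h + v) n)
      ≤⟨ +-mono-≤ (length-meeting (suc i) h v n) (*-monoʳ-≤ 2 (length-patterns (suc i) (h + v) n)) ⟩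
    h * (2 * (2 * (h + v)) ^ n) + 2 * (2 * (h + v)) ^ n
      ≡⟨ +-comm (h * (2 * (2 * (h + v)) ^ n)) (2 * (2 * (h + v)) ^ n) ⟩
    suc h * (2 * (2 * (h + v)) ^ n)
      ≤⟨ *-monoʳ-≤ (suc h) (*-monoʳ-≤ 2 (^-monoˡ-≤ n (*-monoʳ-≤ 2 (n≤1+n (h + v))))) ⟩
    suc h * (2 * (2 * (suc h + v)) ^ n) ∎
    where open ≤-Reasoning

  record IsPattern (i j n : ℕ) (S : Pattern) : Set where
    field
      size   : length S ≡ n
      lower  : All (i ≤_) (vertices S)
      upper  : All (_< j) (vertices S)
      unique : Unique (vertices S)

  open IsPattern public

  pattern-∷ : ∀ {i j n S} b → i < j → IsPattern (suc i) j n S → IsPattern i j (suc n) ((i , b) ∷ S)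
  pattern-∷ b i<j p = record
    { size   = cong suc (size p)
    ; lower  = ≤-refl ∷ All.map <⇒≤ (lower p)
    ; upper  = i<j ∷ upper p
    ; unique = All.map <⇒≢ (lower p) ∷ unique p
    }

  pattern-suc : ∀ {i j n S} → IsPattern (suc i) j n S → IsPattern i j n S
  pattern-suc p = record
    { size   = size p
    ; lower  = All.map <⇒≤ (lower p)
    ; upper  = upper p
    ; unique = unique p
    }

  isPattern : ∀ i v n {S} → S ∈ patterns i v n → IsPattern i (i + v) n S
  isPattern i v       zero    (here refl) = record { size = refl ; lower = [] ; upper = [] ; unique = [] }
  isPattern i (suc v) (suc n) {S} S∈ with ∈-++⁻ (patterns (suc i) v (suc n)) S∈
  ... | inj₁ p = subst (λ j → IsPattern i j (suc n) S) (sym (+-suc i v)) (pattern-suc (isPattern (suc i) v (suc n) p))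
  ... | inj₂ p with ∈-extend⁻ i (patterns (suc i) v n) p
  ...   | b , S′ , refl , S′∈ = pattern-∷ b (m<m+n i z<s)
            (subst (λ j → IsPattern (suc i) j n S′) (sym (+-suc i v)) (isPattern (suc i) v n S′∈))

  meeting⊆patterns : ∀ i h v n {S} → S ∈ meeting i h v n → S ∈ patterns i (h + v) n
  meeting⊆patterns i (suc h) v (suc n) S∈ with ∈-++⁻ (meeting (suc i) h v (suc n)) S∈
  ... | inj₁ p = ∈-++⁺ˡ (meeting⊆patterns (suc i) h v (suc n) p)
  ... | inj₂ p = ∈-++⁺ʳ (patterns (suc i) (h + v) (suc n)) p

  patterns⊆meeting∪patterns : ∀ i h v n {S} → S ∈ patterns i (h + v) n →
                              S ∈ meeting i h v n ⊎ S ∈ patterns (i + h) v n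
  patterns⊆meeting∪patterns i h       v zero    S∈ = inj₂ S∈
  patterns⊆meeting∪patterns i zero    v (suc n) {S} S∈ = 
    inj₂ (subst (λ j → S ∈ patterns j v (suc n)) (sym (+-identityʳ i)) S∈)
  patterns⊆meeting∪patterns i (suc h) v (suc n) {S} S∈ with ∈-++⁻ (patterns (suc i) (h + v) (suc n)) S∈
  ... | inj₂ p = inj₁ (∈-++⁺ʳ (meeting (suc i) h v (suc n)) p)
  ... | inj₁ p with patterns⊆meeting∪patterns (suc i) h v (suc n) p
  ...   | inj₁ q = inj₁ (∈-++⁺ˡ q)
  ...   | inj₂ q = inj₂ (subst (λ j → S ∈ patterns j v (suc n)) (sym (+-suc i h)) q)

  length-cartesianProduct : ∀ {a b} {A : Set a} {B : Set b} (xs : List A) (ys : List B) →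
                            length (cartesianProduct xs ys) ≡ length xs * length ys
  length-cartesianProduct []       ys = refl
  length-cartesianProduct (x ∷ xs) ys = trans (length-++ (map (x ,_) ys))
    (cong₂ _+_ (length-map (x ,_) ys) (length-cartesianProduct xs ys))

  module _ {a} {A : Set a} (f : A → ℕ) where

    sum-≤ : ∀ xs {c} → (∀ {x} → x ∈ xs → f x ≤ c) → sum (map f xs) ≤ length xs * c
    sum-≤ []       h = z≤n
    sum-≤ (x ∷ xs) h = +-mono-≤ (h (here refl)) (sum-≤ xs (h ∘ there))

    ∈⇒≤sum : ∀ {x xs} → x ∈ xs → f x ≤ sum (map f xs)
    ∈⇒≤sum {xs = x ∷ xs} (here refl) = m≤m+n (f x) (sum (map f xs))
    ∈⇒≤sum {xs = x ∷ xs} (there p)   = ≤-trans (∈⇒≤sum p) (m≤n+m (sum (map f xs)) (f x))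

    markov : ∀ {p} {P : A → Set p} (P? : Decidable P) xs {c} → (∀ {x} → x ∈ xs → P x → c ≤ f x) →
             length (filter P? xs) * c ≤ sum (map f xs)
    markov P? []       h = z≤n
    markov P? (x ∷ xs) h with P? x
    ... | yes Px = +-mono-≤ (h (here refl) Px) (markov P? xs (h ∘ there))
    ... | no _   = ≤-trans (markov P? xs (h ∘ there)) (m≤n+m (sum (map f xs)) (f x))

  partition : ∀ {v} → ℕ → Subset v → Subset v → Pattern
  partition i Vec.[]            Vec.[]            = []
  partition i (true  Vec.∷ A) (_     Vec.∷ B) = (i , true) ∷ partition (suc i) A B
  partition i (false Vec.∷ A) (true  Vec.∷ B) = (i , false) ∷ partition (suc i) A B
  partition i (false Vec.∷ A) (false Vec.∷ B) = partition (suc i) A B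

  partition∈patterns : ∀ {v} i n (A B : Subset v) → card (A ∪ B) ≡ n → partition i A B ∈ patterns i v n
  partition∈patterns i zero    Vec.[] Vec.[] e = here refl
  partition∈patterns i (suc n) Vec.[] Vec.[] ()
  partition∈patterns {suc v} i (suc n) (true  Vec.∷ A) (b     Vec.∷ B) e =
    ∈-++⁺ʳ (patterns (suc i) v (suc n)) (∈-extend⁺ i true (partition∈patterns (suc i) n A B (suc-injective e)))
  partition∈patterns {suc v} i (suc n) (false Vec.∷ A) (true  Vec.∷ B) e =
    ∈-++⁺ʳ (patterns (suc i) v (suc n)) (∈-extend⁺ i false (partition∈patterns (suc i) n A B (suc-injective e)))
  partition∈patterns i zero    (false Vec.∷ A) (false Vec.∷ B) e
    with partition (suc i) A B | partition∈patterns (suc i) zero A B e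
  ... | _ | here refl = here refl
  partition∈patterns i (suc n) (false Vec.∷ A) (false Vec.∷ B) e =
    ∈-++⁺ˡ (partition∈patterns (suc i) (suc n) A B e)

  partition-true : ∀ {v} i (A B : Subset v) {a} → a Subset.∈ A → (i + toℕ a , true) ∈ partition i A B
  partition-true i (true Vec.∷ A) (_ Vec.∷ B) Vec.here rewrite +-identityʳ i = here refl
  partition-true i (true Vec.∷ A) (_ Vec.∷ B) {Fin.suc a} (Vec.there p) rewrite +-suc i (toℕ a) =
    there (partition-true (suc i) A B p)
  partition-true i (false Vec.∷ A) (true Vec.∷ B) {Fin.suc a} (Vec.there p) rewrite +-suc i (toℕ a) =
    there (partition-true (suc i) A B p)
  partition-true i (false Vec.∷ A) (false Vec.∷ B) {Fin.suc a} (Vec.there p) rewrite +-suc i (toℕ a) =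
    partition-true (suc i) A B p

  partition-false : ∀ {v} i (A B : Subset v) → A ∩ B ≡ ⊥ → ∀ {b} → b Subset.∈ B →
                    (i + toℕ b , false) ∈ partition i A B
  partition-false i (false Vec.∷ A) (true Vec.∷ B) e Vec.here rewrite +-identityʳ i = here refl
  partition-false i (true Vec.∷ A) (false Vec.∷ B) e {Fin.suc b} (Vec.there p) rewrite +-suc i (toℕ b) =
    there (partition-false (suc i) A B (Vec.∷-injectiveʳ e) p)
  partition-false i (false Vec.∷ A) (true Vec.∷ B) e {Fin.suc b} (Vec.there p) rewrite +-suc i (toℕ b) =
    there (partition-false (suc i) A B (Vec.∷-injectiveʳ e) p)
  partition-false i (false Vec.∷ A) (false Vec.∷ B) e {Fin.suc b} (Vec.there p) rewrite +-suc i (toℕ b) =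
    partition-false (suc i) A B (Vec.∷-injectiveʳ e) p

  -- Choosing the hub edges with one potential.

  hubPairs : ℕ → ℕ → List (ℕ × ℕ)
  hubPairs k v = filter (λ (x , y) → x <? y) (cartesianProduct (upTo k) (upTo v))

  ∈-hubPairs : ∀ {k v x y} → x < k → x < y → y < v → (x , y) ∈ hubPairs k v
  ∈-hubPairs x<k x<y y<v =
    ∈-filter⁺ (λ (x , y) → x <? y) (∈-cartesianProduct⁺ (∈-upTo⁺ x<k) (∈-upTo⁺ y<v)) x<y

  length-hubPairs : ∀ k v → length (hubPairs k v) ≤ k * v
  length-hubPairs k v = ≤-trans (length-filter (λ (x , y) → x <? y) (cartesianProduct (upTo k) (upTo v)))
    (≤-reflexive (trans (length-cartesianProduct (upTo k) (upTo v)) (cong₂ _*_ (length-upTo k) (length-upTo v))))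

  -- No vertex below k realises S, once all hub pairs are decided.
  Unrealised : ℕ → Assignment → Pattern → Set
  Unrealised k w S = failure k w S ≡ (2 ^ length S) ^ k

  unrealised? : ∀ k w → Decidable (Unrealised k w)
  unrealised? k w S = failure k w S ≟ (2 ^ length S) ^ k

  HubEdge : Assignment → ℕ × ℕ → Set
  HubEdge w (x , y) = w x y ≡ just true

  hubEdge? : ∀ w → Decidable (HubEdge w)
  hubEdge? w (x , y) = ≡-dec Bool._≟_ (w x y) (just true)

  hubEdges : ℕ → ℕ → Assignment → List (ℕ × ℕ)
  hubEdges k v w = filter (hubEdge? w) (hubPairs k v)

  unrealisedOutside : ℕ → ℕ → ℕ → Assignment → List Pattern
  unrealisedOutside k v₀ n w = filter (unrealised? k w) (patterns k v₀ n)

  module _ (k v₀ n D c : ℕ) .{{_ : NonZero k}} (1+D≡M : suc D ≡ 2 ^ suc n) (1≤D : 1 ≤ D) where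

    private
      M v : ℕ
      M = 2 ^ suc n
      v = k + v₀

      outside meets : List Pattern
      outside = patterns k v₀ (suc n)
      meets   = meeting 0 k v₀ (suc n)

      instance
        M^k≢0 : NonZero (M ^ k)
        M^k≢0 = m^n≢0 M k {{m^n≢0 2 (suc n)}}

      outside-pattern : ∀ {S} → S ∈ outside → IsPattern k v (suc n) S
      outside-pattern = isPattern k v₀ (suc n)

      meets-pattern : ∀ {S} → S ∈ meets → IsPattern 0 v (suc n) S
      meets-pattern = isPattern 0 v (suc n) ∘ meeting⊆patterns 0 k v₀ (suc n)

      -- One potential controls three quantities, all on the scale `M ^ k`. It starts at no more
      -- than `M ^ k * (suc k * v)`: `k * v` bounds twice the expected number of hub edges, and by
      -- `few` the two failure terms add at most one more `v`. The weight `suc (suc k) * v` is just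
      -- large enough that a single unrealised pattern meeting the hubs would exceed this, while `c`
      -- only limits the number of failures among the other patterns.
      edges fails fails′ F : Assignment → ℕ
      edges  w = sum (map (λ (x , y) → weight true (w x y)) (hubPairs k v))
      fails  w = sum (map (failure k w) outside)
      fails′ w = sum (map (failure k w) meets)
      F w = M ^ k * edges w + (c * fails w + (suc (suc k) * v) * fails′ w)

      F-affine : ∀ w i j → w i j ≡ nothing → Affine w i j F
      F-affine w i j e =
        +-affine w i j {λ u → M ^ k * edges u} {λ u → c * fails u + (suc (suc k) * v) * fails′ u}
          (*-affineʳ w i j {λ _ → M ^ k} {edges} (λ _ → refl)
            (sum-affine w i j (λ u (x , y) → weight true (u x y)) (hubPairs k v)
              λ {(x , y)} _ → weight-affine w i j e true x y))
          (+-affine w i j {λ u → c * fails u} {λ u → (suc (suc k) * v) * fails′ u}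
            (*-affineʳ w i j {λ _ → c} {fails} (λ _ → refl)
              (sum-affine w i j (failure k) outside
                λ {S} S∈ → failure-affine w i j e k S (unique (outside-pattern S∈))))
            (*-affineʳ w i j {λ _ → suc (suc k) * v} {fails′} (λ _ → refl)
              (sum-affine w i j (failure k) meets
                λ {S} S∈ → failure-affine w i j e k S (unique (meets-pattern S∈)))))

    module _ (few : c * ((2 * v) ^ suc n * D ^ k)
                    + (suc (suc k) * v) * (k * (2 * (2 * v) ^ n) * (M * D ^ k)) ≤ v * M ^ k) where

      private
        F-unset : F unset ≤ M ^ k * (suc k * v)
        F-unset = begin
          F unset
            ≤⟨ +-mono-≤ (*-monoʳ-≤ (M ^ k) edges≤)
                 (+-mono-≤ (*-monoʳ-≤ c fails≤) (*-monoʳ-≤ (suc (suc k) * v) fails′≤)) ⟩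
          M ^ k * (k * v) + (c * ((2 * v) ^ suc n * D ^ k)
            + (suc (suc k) * v) * (k * (2 * (2 * v) ^ n) * (M * D ^ k)))
            ≤⟨ +-monoʳ-≤ (M ^ k * (k * v)) few ⟩
          M ^ k * (k * v) + v * M ^ k
            ≡⟨ lemma (M ^ k) k v ⟩
          M ^ k * (suc k * v) ∎
          where
          open ≤-Reasoning
          lemma : ∀ a k v → a * (k * v) + v * a ≡ a * (suc k * v)
          lemma = solve-∀
          edges≤ : edges unset ≤ k * v
          edges≤ = ≤-trans (sum-≤ (λ (x , y) → weight true (unset x y)) (hubPairs k v) (λ _ → ≤-refl))
            (≤-trans (≤-reflexive (*-identityʳ (length (hubPairs k v)))) (length-hubPairs k v))
          fails≤ : fails unset ≤ (2 * v) ^ suc n * D ^ k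
          fails≤ = ≤-trans
            (sum-≤ (failure k unset) outside λ {S} S∈ → ≤-reflexive
              (failure-unset-outside 1+D≡M 1≤D k S (cong (2 ^_) (size (outside-pattern S∈)))
                (lower (outside-pattern S∈))))
            (*-monoˡ-≤ (D ^ k) (≤-trans (length-patterns k v₀ (suc n))
              (^-monoˡ-≤ (suc n) (*-monoʳ-≤ 2 (m≤n+m v₀ k)))))
          fails′≤ : fails′ unset ≤ k * (2 * (2 * v) ^ n) * (M * D ^ k)
          fails′≤ = ≤-trans
            (sum-≤ (failure k unset) meets λ {S} S∈ →
              failure-unset-≤ 1+D≡M 1≤D k S (cong (2 ^_) (size (meets-pattern S∈))))
            (*-monoˡ-≤ (M * D ^ k) (length-meeting 0 k v₀ n))

      hubs : ∃ λ w →
        (∀ {x y} → x < k → x < y → y < k + v₀ → ∃ λ b → w x y ≡ just b) ×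
        (∀ {S} → S ∈ meeting 0 k v₀ (suc n) → ¬ Unrealised k w S) ×
        2 * length (hubEdges k (k + v₀) w) ≤ suc k * (k + v₀) ×
        c * length (unrealisedOutside k v₀ (suc n) w) ≤ suc k * (k + v₀)
      hubs with derandomise F F-affine (hubPairs k v) unset
      ... | w , F≤ , decided =
        w , (λ x<k x<y y<v → decided (∈-hubPairs x<k x<y y<v)) , realised , few-edges , few-fails
        where
        open ≤-Reasoning
        total : F w ≤ M ^ k * (suc k * v)
        total = ≤-trans F≤ F-unset

        full : ∀ {i j S} → IsPattern i j (suc n) S → Unrealised k w S → failure k w S ≡ M ^ k
        full p u = trans u (cong (λ l → (2 ^ l) ^ k) (size p))

        realised : ∀ {S} → S ∈ meets → ¬ Unrealised k w S
        realised {S} S∈ u = <⇒≱ (*-monoʳ-< (M ^ k) (m<n+m (suc k * v) (>-nonZero⁻¹ v {{m+n≢0 k v₀}}))) (begin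
          M ^ k * (suc (suc k) * v)
            ≡⟨ *-comm (M ^ k) (suc (suc k) * v) ⟩
          suc (suc k) * v * M ^ k
            ≡⟨ cong (suc (suc k) * v *_) (full (meets-pattern S∈) u) ⟨
          suc (suc k) * v * failure k w S
            ≤⟨ *-monoʳ-≤ (suc (suc k) * v) (∈⇒≤sum (failure k w) S∈) ⟩
          suc (suc k) * v * fails′ w
            ≤⟨ m≤n+m _ (c * fails w) ⟩
          c * fails w + suc (suc k) * v * fails′ w
            ≤⟨ m≤n+m _ (M ^ k * edges w) ⟩
          F w
            ≤⟨ total ⟩
          M ^ k * (suc k * v) ∎)
          where
          m+n≢0 : ∀ m n .{{_ : NonZero m}} → NonZero (m + n)
          m+n≢0 (suc m) n = _

        few-edges : 2 * length (hubEdges k v w) ≤ suc k * v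
        few-edges = *-cancelˡ-≤ (M ^ k) (begin
          M ^ k * (2 * length (hubEdges k v w)) ≡⟨ cong (M ^ k *_) (*-comm 2 (length (hubEdges k v w))) ⟩
          M ^ k * (length (hubEdges k v w) * 2)
            ≤⟨ *-monoʳ-≤ (M ^ k) (markov (λ (x , y) → weight true (w x y)) (hubEdge? w) (hubPairs k v)
                 λ {(x , y)} _ e → ≤-reflexive (cong (weight true) (sym e))) ⟩
          M ^ k * edges w                   ≤⟨ m≤m+n _ _ ⟩
          F w                               ≤⟨ total ⟩
          M ^ k * (suc k * v)               ∎)

        few-fails : c * length (unrealisedOutside k v₀ (suc n) w) ≤ suc k * v
        few-fails = *-cancelˡ-≤ (M ^ k) (begin
          M ^ k * (c * length (unrealisedOutside k v₀ (suc n) w))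
            ≡⟨ lemma (M ^ k) c (length (unrealisedOutside k v₀ (suc n) w)) ⟩
          c * (length (unrealisedOutside k v₀ (suc n) w) * M ^ k) ≤⟨ *-monoʳ-≤ c
            (markov (failure k w) (unrealised? k w) outside
              λ S∈ u → ≤-reflexive (sym (full (outside-pattern S∈) u))) ⟩
          c * fails w                                ≤⟨ m≤m+n _ _ ⟩
          c * fails w + suc (suc k) * v * fails′ w   ≤⟨ m≤n+m _ (M ^ k * edges w) ⟩
          F w                                        ≤⟨ total ⟩
          M ^ k * (suc k * v)                        ∎)
          where
          lemma : ∀ a b c → a * (b * c) ≡ b * (c * a)
          lemma = solve-∀

  -- Repairing the unrealised patterns.

  module _ {a b} {A : Set a} {B : Set b} where

    zip-∈ : ∀ xs ys {x : A} {y : B} → (x , y) ∈ zip xs ys → x ∈ xs × y ∈ ys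
    zip-∈ (x ∷ xs) (y ∷ ys) (here refl) = here refl , here refl
    zip-∈ (x ∷ xs) (y ∷ ys) (there p)   = let q , r = zip-∈ xs ys p in there q , there r

    zip-total : ∀ (xs : List A) (ys : List B) → length ys ≤ length xs → ∀ {y} → y ∈ ys → ∃ λ x → (x , y) ∈ zip xs ys
    zip-total (x ∷ xs) (y ∷ ys) (s≤s l) (here refl) = x , here refl
    zip-total (x ∷ xs) (y ∷ ys) (s≤s l) (there p)   = let x′ , q = zip-total xs ys l p in x′ , there q

    zip-functional : ∀ xs ys {x : A} {y y′ : B} → Unique xs → (x , y) ∈ zip xs ys → (x , y′) ∈ zip xs ys → y ≡ y′
    zip-functional (x ∷ xs) (y ∷ ys) u          (here refl) (here refl) = refl
    zip-functional (x ∷ xs) (y ∷ ys) (x∉xs ∷ u) (here refl) (there q)   =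
      contradiction refl (All.lookup x∉xs (proj₁ (zip-∈ xs ys q)))
    zip-functional (x ∷ xs) (y ∷ ys) (x∉xs ∷ u) (there p)   (here refl) =
      contradiction refl (All.lookup x∉xs (proj₁ (zip-∈ xs ys p)))
    zip-functional (x ∷ xs) (y ∷ ys) (_ ∷ u)    (there p)   (there q)   = zip-functional xs ys u p q

  unique-vertex : ∀ {S : Pattern} → Unique (vertices S) → ∀ {x b c} → (x , b) ∈ S → (x , c) ∈ S → b ≡ c
  unique-vertex u         (here refl) (here refl) = refl
  unique-vertex (x∉ ∷ u)  (here refl) (there q)   = contradiction refl (All.lookup x∉ (∈-map⁺ proj₁ q))
  unique-vertex (x∉ ∷ u)  (there p)   (here refl) = contradiction refl (All.lookup x∉ (∈-map⁺ proj₁ p))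
  unique-vertex (_ ∷ u)   (there p)   (there q)   = unique-vertex u p q

  edgeCount-≤ : ∀ {v} (G : Graph v) (E : List (ℕ × ℕ)) →
                (∀ {i j} → i Fin.< j → Graph._~_ G i j → (toℕ i , toℕ j) ∈ E) → edgeCount G ≤ length E
  edgeCount-≤ {v} G E cover = begin
    length edges            ≡⟨ length-map toℕ² edges ⟨
    length (map toℕ² edges) ≤⟨ unique∧⊆⇒length≤ (Unique.map⁺ toℕ²-injective edges-unique) edges⊆E ⟩
    length E                ∎
    where
    open ≤-Reasoning
    open Graph G
    edge? : Decidable (λ ((i , j) : Fin v × Fin v) → i Fin.< j × i ~ j)
    edge? (i , j) = (i Fin.<? j) ×-dec (i ~? j)
    pairs edges : List (Fin v × Fin v)
    pairs = cartesianProduct (allFin v) (allFin v)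
    edges = filter edge? pairs
    edges-unique : Unique edges
    edges-unique = Unique.filter⁺ edge? (Unique.cartesianProduct⁺ (Unique.allFin⁺ v) (Unique.allFin⁺ v))
    toℕ² : Fin v × Fin v → ℕ × ℕ
    toℕ² (i , j) = toℕ i , toℕ j
    toℕ²-injective : ∀ {p q} → toℕ² p ≡ toℕ² q → p ≡ q
    toℕ²-injective e = cong₂ _,_ (toℕ-injective (cong proj₁ e)) (toℕ-injective (cong proj₂ e))
    edges⊆E : map toℕ² edges ⊆ E
    edges⊆E p with ∈-map⁻ toℕ² p
    ... | (i , j) , ij∈ , refl =
      let _ , i<j , i~j = ∈-filter⁻ edge? {xs = pairs} ij∈ in cover i<j i~j

  module Repair
    (k v₀ n : ℕ) (w : Assignment)
    (decided : ∀ {x y} → x < k → x < y → y < k + v₀ → ∃ λ b → w x y ≡ just b)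
    (realised : ∀ {S} → S ∈ meeting 0 k v₀ n → ¬ Unrealised k w S)
    (room : length (unrealisedOutside k v₀ n w) * suc n ≤ v₀)
    where

    v : ℕ
    v = k + v₀

    outside bad : List Pattern
    outside = patterns k v₀ n
    bad     = unrealisedOutside k v₀ n w

    used nonHubs fresh : List ℕ
    used    = concatMap vertices bad
    nonHubs = map (k +_) (upTo v₀)
    fresh   = filter (λ x → ¬? (x ∈? used)) nonHubs

    repairs : List (ℕ × Pattern)
    repairs = zip fresh bad

    added : List (ℕ × ℕ × Bool)
    added = concatMap (λ (z , S) → map (z ,_) S) repairs

    ∈-added⁺ : ∀ {z S s} → (z , S) ∈ repairs → s ∈ S → (z , s) ∈ added
    ∈-added⁺ {z} zS∈ s∈S = ∈-concat⁺′ (∈-map⁺ (z ,_) s∈S) (∈-map⁺ (λ (z , S) → map (z ,_) S) zS∈)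

    ∈-added⁻ : ∀ {z s} → (z , s) ∈ added → ∃ λ S → (z , S) ∈ repairs × s ∈ S
    ∈-added⁻ p with ∈-concat⁻′ (map (λ (z , S) → map (z ,_) S) repairs) p
    ... | l , p∈l , l∈ with ∈-map⁻ (λ (z , S) → map (z ,_) S) l∈
    ...   | (z , S) , zS∈ , refl with ∈-map⁻ (z ,_) p∈l
    ...     | s , s∈S , refl = S , zS∈ , s∈S

    bad-outside : ∀ {S} → S ∈ bad → S ∈ outside
    bad-outside S∈ = proj₁ (∈-filter⁻ (unrealised? k w) {xs = outside} S∈)

    bad-pattern : ∀ {S} → S ∈ bad → IsPattern k v n S
    bad-pattern = isPattern k v₀ n ∘ bad-outside

    length-used : ∀ (Ss : List Pattern) → (∀ {S} → S ∈ Ss → length S ≡ n) →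
                  length (concatMap vertices Ss) ≡ length Ss * n
    length-used []       h = refl
    length-used (S ∷ Ss) h = trans (length-++ (vertices S))
      (cong₂ _+_ (trans (length-map proj₁ S) (h (here refl))) (length-used Ss (h ∘ there)))

    length-added : ∀ (xs : List ℕ) (Ss : List Pattern) → (∀ {S} → S ∈ Ss → length S ≡ n) →
                   length (concatMap (λ (z , S) → map (z ,_) S) (zip xs Ss)) ≤ length Ss * n
    length-added []       _        h = z≤n
    length-added (x ∷ xs) []       h = z≤n
    length-added (x ∷ xs) (S ∷ Ss) h = ≤-trans
      (≤-reflexive (length-++ (map (x ,_) S)))
      (+-mono-≤ (≤-reflexive (trans (length-map (x ,_) S) (h (here refl)))) (length-added xs Ss (h ∘ there)))

    fresh-unique : Unique fresh
    fresh-unique = Unique.filter⁺ (λ x → ¬? (x ∈? used)) (Unique.map⁺ (+-cancelˡ-≡ k _ _) (Unique.upTo⁺ v₀))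

    -- `used` and `fresh` together cover the non-hubs. Each bad pattern uses up `n` of them and
    -- needs one more of its own, which is the `suc n` in `room`.
    enough-fresh : length bad ≤ length fresh
    enough-fresh = +-cancelˡ-≤ (length used) (length bad) (length fresh) (begin
      length used + length bad            ≡⟨ cong (_+ length bad) (length-used bad (size ∘ bad-pattern)) ⟩
      length bad * n + length bad         ≡⟨ +-comm (length bad * n) (length bad) ⟩
      length bad + length bad * n         ≡⟨ *-suc (length bad) n ⟨
      length bad * suc n                  ≤⟨ room ⟩
      v₀                                  ≡⟨ trans (length-map (k +_) (upTo v₀)) (length-upTo v₀) ⟨
      length nonHubs                      ≤⟨ unique∧⊆⇒length≤ (Unique.map⁺ (+-cancelˡ-≡ k _ _) (Unique.upTo⁺ v₀)) cover ⟩
      length (used ++ fresh)              ≡⟨ length-++ used ⟩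
      length used + length fresh          ∎)
      where
      open ≤-Reasoning
      cover : nonHubs ⊆ (used ++ fresh)
      cover {x} x∈ = case x ∈? used of λ where
        (yes p) → ∈-++⁺ˡ p
        (no p)  → ∈-++⁺ʳ used (∈-filter⁺ (λ x → ¬? (x ∈? used)) x∈ p)

    fresh-bounds : ∀ {z} → z ∈ fresh → k ≤ z × z < v × z ∉ used
    fresh-bounds z∈ with ∈-filter⁻ (λ x → ¬? (x ∈? used)) {xs = nonHubs} z∈
    ... | z∈′ , z∉ with ∈-map⁻ (k +_) z∈′
    ...   | i , i∈ , refl = m≤m+n k i , +-monoʳ-< k (∈-upTo⁻ i∈) , z∉

    ∈-used : ∀ {S s b} → S ∈ bad → (s , b) ∈ S → s ∈ used
    ∈-used S∈ s∈ = ∈-concat⁺′ (∈-map⁺ proj₁ s∈) (∈-map⁺ vertices S∈)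

    added-source : ∀ {x y b} → (x , y , b) ∈ added → x ∈ fresh
    added-source p = let _ , xS∈ , _ = ∈-added⁻ p in proj₁ (zip-∈ fresh bad xS∈)

    added-target : ∀ {x y b} → (x , y , b) ∈ added → y ∈ used × k ≤ y
    added-target p =
      let S , xS∈ , y∈S = ∈-added⁻ p
          S∈ = proj₂ (zip-∈ fresh bad xS∈)
      in ∈-used S∈ y∈S , All.lookup (lower (bad-pattern S∈)) (∈-map⁺ proj₁ y∈S)

    HubAdjacent Added Adjacent : ℕ → ℕ → Set
    HubAdjacent x y = x ⊓ y < k × w ⟨ x , y ⟩ ≡ just true
    Added x y       = (x , y , true) ∈ added
    Adjacent x y    = x ≢ y × (HubAdjacent x y ⊎ Added x y ⊎ Added y x)

    open import Data.List.Membership.DecPropositional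
      (Product.≡-dec _≟_ (Product.≡-dec _≟_ Bool._≟_)) using () renaming (_∈?_ to _∈₃?_)

    adjacent? : ∀ x y → Dec (Adjacent x y)
    adjacent? x y = ¬? (x ≟ y) ×-dec
      ((x ⊓ y <? k ×-dec ≡-dec Bool._≟_ (w ⟨ x , y ⟩) (just true))
        ⊎-dec ((x , y , true) ∈₃? added) ⊎-dec ((y , x , true) ∈₃? added))

    adjacent-sym : ∀ {x y} → Adjacent x y → Adjacent y x
    adjacent-sym {x} {y} (x≢y , inj₁ h) = x≢y ∘ sym ,
      inj₁ (subst₂ (λ a b → a < k × w a b ≡ just true) (⊓-comm x y) (⊔-comm x y) h)
    adjacent-sym (x≢y , inj₂ (inj₁ p)) = x≢y ∘ sym , inj₂ (inj₂ p)
    adjacent-sym (x≢y , inj₂ (inj₂ p)) = x≢y ∘ sym , inj₂ (inj₁ p)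

    graph : Graph v
    graph = record
      { _~_      = λ i j → Adjacent (toℕ i) (toℕ j)
      ; _~?_     = λ i j → adjacent? (toℕ i) (toℕ j)
      ; ~-sym    = adjacent-sym
      ; ~-irrefl = λ { refl (x≢x , _) → x≢x refl }
      }

    Good : ℕ → Pattern → Set
    Good z S = z < v × z ∉ vertices S ×
      (∀ {s} → (s , true) ∈ S → Adjacent z s) × (∀ {s} → (s , false) ∈ S → ¬ Adjacent z s)

    hub-good : ∀ {z S} → z < k → z ∉ vertices S → Realises w z S → Good z S
    hub-good {z} {S} z<k z∉S r = <-≤-trans z<k (m≤m+n k v₀) , z∉S , adj , non
      where
      adj : ∀ {s} → (s , true) ∈ S → Adjacent z s
      adj {s} s∈ = (λ { refl → z∉S (∈-map⁺ proj₁ s∈) }) , inj₁ (≤-<-trans (m⊓n≤m z s) z<k , r s true s∈)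
      non : ∀ {s} → (s , false) ∈ S → ¬ Adjacent z s
      non {s} s∈ (_ , inj₁ (_ , e)) with trans (sym e) (r s false s∈)
      ... | ()
      non s∈ (_ , inj₂ (inj₁ p)) = <⇒≱ z<k (proj₁ (fresh-bounds (added-source p)))
      non s∈ (_ , inj₂ (inj₂ p)) = <⇒≱ z<k (proj₂ (added-target p))

    -- The added edges at `z` are exactly those demanded by `S`: `z` is paired with one bad pattern
    -- only, as `fresh` has no repetitions, and it cannot be the far end of another repair, as those
    -- ends lie in `used`. Hub edges do not interfere, because neither `z` nor any vertex of `S` is
    -- a hub.
    fresh-good : ∀ {S} → S ∈ bad → ∃ λ z → Good z S
    fresh-good {S} S∈ with zip-total fresh bad enough-fresh S∈
    ... | z , zS∈ = z , z<v , z∉S , adj , non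
      where
      z∈fresh = proj₁ (zip-∈ fresh bad zS∈)
      k≤z = proj₁ (fresh-bounds z∈fresh)
      z<v = proj₁ (proj₂ (fresh-bounds z∈fresh))
      z∉used = proj₂ (proj₂ (fresh-bounds z∈fresh))
      z∉S : z ∉ vertices S
      z∉S z∈ with ∈-map⁻ proj₁ z∈
      ... | _ , p , refl = z∉used (∈-used S∈ p)
      adj : ∀ {s} → (s , true) ∈ S → Adjacent z s
      adj {s} s∈ = (λ { refl → z∉S (∈-map⁺ proj₁ s∈) }) , inj₂ (inj₁ (∈-added⁺ zS∈ s∈))
      non : ∀ {s} → (s , false) ∈ S → ¬ Adjacent z s
      non {s} s∈ (_ , inj₁ (m<k , _)) =
        <⇒≱ m<k (⊓-glb k≤z (All.lookup (lower (bad-pattern S∈)) (∈-map⁺ proj₁ s∈)))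
      non {s} s∈ (_ , inj₂ (inj₁ p)) with ∈-added⁻ p
      ... | S′ , zS′∈ , s∈′ with zip-functional fresh bad fresh-unique zS∈ zS′∈
      ...   | refl with unique-vertex (unique (bad-pattern S∈)) s∈ s∈′
      ...     | ()
      non {s} s∈ (_ , inj₂ (inj₂ p)) = z∉used (proj₁ (added-target p))

    ⊓<⊔ : ∀ {x y} → x ≢ y → x ⊓ y < x ⊔ y
    ⊓<⊔ {x} {y} x≢y = ≤∧≢⇒< (≤-trans (m⊓n≤m x y) (m≤m⊔n x y)) λ e → x≢y (≤-antisym
      (≤-trans (m≤m⊔n x y) (≤-trans (≤-reflexive (sym e)) (m⊓n≤n x y)))
      (≤-trans (m≤n⊔m x y) (≤-trans (≤-reflexive (sym e)) (m⊓n≤m x y))))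

    decided-⟨⟩ : ∀ {z s} → z < k → s < v → z ≢ s → ∃ λ b → w ⟨ z , s ⟩ ≡ just b
    decided-⟨⟩ {z} {s} z<k s<v z≢s = decided (≤-<-trans (m⊓n≤m z s) z<k) (⊓<⊔ z≢s)
      (⊔-lub (<-≤-trans z<k (m≤m+n k v₀)) s<v)

    good : ∀ {S} → S ∈ patterns 0 v n → ∃ λ z → Good z S
    good {S} S∈ with failure-decided k w S (λ z<k s∈S →
         decided-⟨⟩ z<k (All.lookup (upper (isPattern 0 v n S∈)) s∈S))
    ... | inj₂ (z , z<k , z∉S , r) = z , hub-good z<k z∉S r
    ... | inj₁ u with patterns⊆meeting∪patterns 0 k v₀ n S∈
    ...   | inj₁ m = contradiction u (realised m)
    ...   | inj₂ o = fresh-good (∈-filter⁺ (unrealised? k w) o u)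

    existentiallyClosed : IsExistentiallyClosed n graph
    existentiallyClosed S A B size refl disjoint
      with good (partition∈patterns 0 n A B size)
    ... | z , z<v , z∉ , adj , non = fromℕ< z<v , z∉S , (λ {a} → adjA {a}) , (λ {b} → nonB {b})
      where
      z≡ : toℕ (fromℕ< z<v) ≡ z
      z≡ = toℕ-fromℕ< z<v
      z∉S : fromℕ< z<v Subset.∉ A ∪ B
      z∉S p with x∈p∪q⁻ A B p
      ... | inj₁ q = z∉ (subst (_∈ vertices (partition 0 A B)) z≡ (∈-map⁺ proj₁ (partition-true 0 A B q)))
      ... | inj₂ q = z∉ (subst (_∈ vertices (partition 0 A B)) z≡ (∈-map⁺ proj₁ (partition-false 0 A B disjoint q)))
      adjA : ∀ {a} → a Subset.∈ A → Adjacent (toℕ (fromℕ< z<v)) (toℕ a)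
      adjA {a} p = subst (λ x → Adjacent x (toℕ a)) (sym z≡) (adj (partition-true 0 A B p))
      nonB : ∀ {b} → b Subset.∈ B → ¬ Adjacent (toℕ (fromℕ< z<v)) (toℕ b)
      nonB {b} p q = non (partition-false 0 A B disjoint p) (subst (λ x → Adjacent x (toℕ b)) z≡ q)

    -- `edgeCount` lists an edge with its smaller end first, and the repairing vertex may be either
    -- end. Both orientations are therefore entered in the covering list, at the price of a factor
    -- 2.
    edges-≤ : edgeCount graph ≤ length (hubEdges k v w) + 2 * (length bad * n)
    edges-≤ = begin
      edgeCount graph
        ≤⟨ edgeCount-≤ graph (hubEdges k v w ++ map forward added ++ map backward added)
             (λ {i} {j} → cover {i} {j}) ⟩
      length (hubEdges k v w ++ map forward added ++ map backward added)
        ≡⟨ trans (length-++ (hubEdges k v w))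
             (cong (length (hubEdges k v w) +_) (length-++ (map forward added))) ⟩
      length (hubEdges k v w) + (length (map forward added) + length (map backward added))
        ≡⟨ cong₂ (λ a b → length (hubEdges k v w) + (a + b)) (length-map forward added)
             (trans (length-map backward added) (sym (+-identityʳ _))) ⟩
      length (hubEdges k v w) + 2 * length added
        ≤⟨ +-monoʳ-≤ (length (hubEdges k v w)) (*-monoʳ-≤ 2 (length-added fresh bad (size ∘ bad-pattern))) ⟩
      length (hubEdges k v w) + 2 * (length bad * n) ∎
      where
      open ≤-Reasoning
      forward backward : ℕ × ℕ × Bool → ℕ × ℕ
      forward  (x , y , _) = x , y
      backward (x , y , _) = y , x
      cover : ∀ {i j : Fin v} → i Fin.< j → Adjacent (toℕ i) (toℕ j) →
              (toℕ i , toℕ j) ∈ hubEdges k v w ++ map forward added ++ map backward added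
      cover i<j (_ , inj₂ (inj₁ q)) = ∈-++⁺ʳ (hubEdges k v w) (∈-++⁺ˡ (∈-map⁺ forward q))
      cover i<j (_ , inj₂ (inj₂ q)) = ∈-++⁺ʳ (hubEdges k v w) (∈-++⁺ʳ (map forward added) (∈-map⁺ backward q))
      cover {i} {j} i<j (_ , inj₁ (i<k , e)) = ∈-++⁺ˡ (∈-filter⁺ (hubEdge? w)
          (∈-hubPairs (subst (_< k) ⊓≡ i<k) i<j (toℕ<n j)) (subst₂ (λ x y → w x y ≡ just true) ⊓≡ ⊔≡ e))
        where
        ⊓≡ : toℕ i ⊓ toℕ j ≡ toℕ i
        ⊓≡ = m≤n⇒m⊓n≡m (<⇒≤ i<j)
        ⊔≡ : toℕ i ⊔ toℕ j ≡ toℕ j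
        ⊔≡ = m≤n⇒m⊔n≡n (<⇒≤ i<j)

  -- The number of edges after the repairs.

  module _ (k v₀ n : ℕ) .{{_ : NonZero k}} (k≤v₀ : k ≤ v₀) (w : Assignment)
    (decided : ∀ {x y} → x < k → x < y → y < k + v₀ → ∃ λ b → w x y ≡ just b)
    (realised : ∀ {S} → S ∈ meeting 0 k v₀ n → ¬ Unrealised k w S)
    (few-edges : 2 * length (hubEdges k (k + v₀) w) ≤ suc k * (k + v₀))
    (few-bad : 4 * suc n * k * length (unrealisedOutside k v₀ n w) ≤ suc k * (k + v₀))
    where

    private
      open ≤-Reasoning
      v b : ℕ
      v = k + v₀
      b = length (unrealisedOutside k v₀ n w)

      -- The weight `4 * suc n * k` of the failures is made for this bound. It serves twice: with
      -- `v ≤ 2 * v₀` it leaves enough fresh vertices, and it limits the repairs to `2 * v` on the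
      -- doubled scale.
      bad≤ : 4 * suc n * b ≤ 2 * v
      bad≤ = *-cancelˡ-≤ k (begin
        k * (4 * suc n * b) ≡⟨ lemma₁ k (4 * suc n) b ⟩
        4 * suc n * k * b   ≤⟨ few-bad ⟩
        suc k * v           ≤⟨ *-monoˡ-≤ v (+-monoˡ-≤ k (>-nonZero⁻¹ k)) ⟩
        (k + k) * v         ≡⟨ lemma₂ k v ⟩
        k * (2 * v)         ∎)
        where
        lemma₁ : ∀ k m b → k * (m * b) ≡ m * k * b
        lemma₁ = solve-∀
        lemma₂ : ∀ k v → (k + k) * v ≡ k * (2 * v)
        lemma₂ = solve-∀

      room : b * suc n ≤ v₀
      room = *-cancelˡ-≤ 4 (begin
        4 * (b * suc n) ≡⟨ lemma₁ b (suc n) ⟩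
        4 * suc n * b   ≤⟨ bad≤ ⟩
        2 * v           ≤⟨ *-monoʳ-≤ 2 (+-monoˡ-≤ v₀ k≤v₀) ⟩
        2 * (v₀ + v₀)   ≡⟨ lemma₂ v₀ ⟩
        4 * v₀          ∎)
        where
        lemma₁ : ∀ b m → 4 * (b * m) ≡ 4 * m * b
        lemma₁ = solve-∀
        lemma₂ : ∀ v₀ → 2 * (v₀ + v₀) ≡ 4 * v₀
        lemma₂ = solve-∀

      module R = Repair k v₀ n w decided realised room

    repaired-graph : ∃ λ (G : Graph (k + v₀)) → IsExistentiallyClosed n G × 2 * edgeCount G ≤ (k + 3) * (k + v₀)
    repaired-graph = R.graph , R.existentiallyClosed , (begin
      2 * edgeCount R.graph                        ≤⟨ *-monoʳ-≤ 2 R.edges-≤ ⟩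
      2 * (length (hubEdges k v w) + 2 * (b * n))  ≡⟨ lemma₁ (length (hubEdges k v w)) b n ⟩
      2 * length (hubEdges k v w) + 4 * n * b      ≤⟨ +-mono-≤ few-edges
                                                        (≤-trans (*-monoˡ-≤ b (*-monoʳ-≤ 4 (n≤1+n n))) bad≤) ⟩
      suc k * v + 2 * v                            ≡⟨ lemma₂ k v ⟩
      (k + 3) * v                                  ∎)
      where
      lemma₁ : ∀ h b n → 2 * (h + 2 * (b * n)) ≡ 2 * h + 4 * n * b
      lemma₁ = solve-∀
      lemma₂ : ∀ k v → suc k * v + 2 * v ≡ (k + 3) * v
      lemma₂ = solve-∀

  sparse-graph : ∀ k v₀ n D .{{_ : NonZero k}} → suc D ≡ 2 ^ suc n → 1 ≤ D → k ≤ v₀ →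
    4 * suc (suc n) * k * ((2 * (k + v₀)) ^ suc n * D ^ k)
      + (suc (suc k) * (k + v₀)) * (k * (2 * (2 * (k + v₀)) ^ n) * (2 ^ suc n * D ^ k)) ≤ (k + v₀) * (2 ^ suc n) ^ k →
    ∃ λ (G : Graph (k + v₀)) → IsExistentiallyClosed (suc n) G × 2 * edgeCount G ≤ (k + 3) * (k + v₀)
  sparse-graph k v₀ n D 1+D≡M 1≤D k≤v₀ few =
    let w , decided , realised , few-edges , few-bad = hubs k v₀ n D (4 * suc (suc n) * k) 1+D≡M 1≤D few
    in repaired-graph k v₀ (suc n) k≤v₀ w decided realised few-edges few-bad

  -- The minimum number of edges is attained.

  allSubsets? : ∀ {v p} {P : Pred (Subset v) p} → Decidable P → Dec (∀ A → P A)
  allSubsets? P? with anySubset? (¬? ∘ P?)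
  ... | yes (A , ¬PA) = no λ P → ¬PA (P A)
  ... | no ∄¬P        = yes λ A → decidable-stable (P? A) (λ ¬PA → ∄¬P (A , ¬PA))

  module _ {v : ℕ} where

    existentiallyClosed? : ∀ n (G : Graph v) → Dec (IsExistentiallyClosed n G)
    existentiallyClosed? n G =
      allSubsets? λ S → allSubsets? λ A → allSubsets? λ B →
        (card S ≟ n) →-dec ((A ∪ B) ≟ˢ S) →-dec ((A ∩ B) ≟ˢ ⊥) →-dec Fin.any? λ z →
          ¬? (z Subset.∈? S) ×-dec every (λ a → (a Subset.∈? A) →-dec (z ~? a))
                             ×-dec every (λ b → (b Subset.∈? B) →-dec ¬? (z ~? b))
      where
      open Graph G
      _≟ˢ_ : (A B : Subset v) → Dec (A ≡ B)
      _≟ˢ_ = Vec.≡-dec Bool._≟_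
      every : ∀ {p} {P : Pred (Fin v) p} → Decidable P → Dec (∀ {a} → P a)
      every P? with Fin.all? P?
      ... | yes h = yes λ {a} → h a
      ... | no ¬h = no λ h → ¬h λ a → h {a}

    module _ (G H : Graph v)
             (G⇒H : ∀ {i j} → Graph._~_ G i j → Graph._~_ H i j)
             (H⇒G : ∀ {i j} → Graph._~_ H i j → Graph._~_ G i j) where

      private
        module G = Graph G
        module H = Graph H

      existentiallyClosed-resp : ∀ n → IsExistentiallyClosed n G → IsExistentiallyClosed n H
      existentiallyClosed-resp n ec S A B s u d =
        let z , z∉S , adj , non = ec S A B s u d
        in z , z∉S , (λ a∈A → G⇒H (adj a∈A)) , λ b∈B z~b → non b∈B (H⇒G z~b)

      edgeCount-resp : edgeCount G ≡ edgeCount H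
      edgeCount-resp = cong length (filter-≐
        (λ (i , j) → (i Fin.<? j) ×-dec (i G.~? j)) (λ (i , j) → (i Fin.<? j) ×-dec (i H.~? j))
        ((λ (i<j , i~j) → i<j , G⇒H i~j) , (λ (i<j , i~j) → i<j , H⇒G i~j))
        (cartesianProduct (allFin v) (allFin v)))

    -- A `Graph` carries an arbitrary relation and cannot be searched, so graphs are coded by sets
    -- of ordered pairs. Taking the symmetric, loopless part makes every code a graph.
    decode : Subset (v * v) → Graph v
    decode p = record
      { _~_      = λ i j → i ≢ j × combine i j Subset.∈ p × combine j i Subset.∈ p
      ; _~?_     = λ i j → ¬? (i Fin.≟ j) ×-dec (combine i j Subset.∈? p) ×-dec (combine j i Subset.∈? p)
      ; ~-sym    = λ (i≢j , q , r) → i≢j ∘ sym , r , q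
      ; ~-irrefl = λ i≡j (i≢j , _) → i≢j i≡j
      }

    module _ (G : Graph v) where
      open Graph G

      private
        adjacent : Fin v × Fin v → Bool
        adjacent (i , j) = does (i ~? j)

      encode : Subset (v * v)
      encode = Vec.tabulate (adjacent ∘ remQuot v)

      private
        lookup-encode : ∀ i j → Vec.lookup encode (combine i j) ≡ does (i ~? j)
        lookup-encode i j = trans (Vec.lookup∘tabulate (adjacent ∘ remQuot v) (combine i j))
                                  (cong adjacent (remQuot-combine i j))

        encode⁺ : ∀ {i j} → i ~ j → combine i j Subset.∈ encode
        encode⁺ {i} {j} i~j = Vec.lookup⇒[]= (combine i j) encode
          (trans (lookup-encode i j) (dec-true (i ~? j) i~j))

        encode⁻ : ∀ {i j} → combine i j Subset.∈ encode → i ~ j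
        encode⁻ {i} {j} p = decidable-stable (i ~? j) λ i≁j →
          case trans (sym (Vec.[]=⇒lookup p)) (trans (lookup-encode i j) (dec-false (i ~? j) i≁j)) of λ ()

      ~⇒decode : ∀ {i j} → i ~ j → Graph._~_ (decode encode) i j
      ~⇒decode i~j = (λ i≡j → ~-irrefl i≡j i~j) , encode⁺ i~j , encode⁺ (~-sym i~j)

      decode⇒~ : ∀ {i j} → Graph._~_ (decode encode) i j → i ~ j
      decode⇒~ (_ , p , _) = encode⁻ p

  least : ∀ {p} {P : Pred ℕ p} → Decidable P → ∀ b → P b → ∃ λ m → P m × (∀ {i} → P i → m ≤ i)
  least {P = P} P? b Pb = search b (λ _ → z≤n) (subst P (sym (+-identityʳ b)) Pb)
    where
    Below : ℕ → Set _
    Below k = ∀ {i} → P i → k ≤ i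
    search : ∀ d {k} → Below k → P (d + k) → ∃ λ m → P m × (∀ {i} → P i → m ≤ i)
    search zero    {k} below Pk = k , Pk , below
    search (suc d) {k} below Pd with P? k
    ... | yes Pk = k , Pk , below
    ... | no ¬Pk = search d {suc k} (λ {i} Pi → ≤∧≢⇒< (below Pi) λ { refl → ¬Pk Pi })
                     (subst P (sym (+-suc d k)) Pd)

  -- An upper bound on edges does not by itself produce the value `m(v,n)`. Over the finitely many
  -- codes it is decidable whether a given size occurs, so a least size can be found; every graph
  -- agrees with the decoding of its code in adjacency, hence in closedness and size.
  minEdgeCount : ∀ {v} n (G : Graph v) → IsExistentiallyClosed n G →
                 ∃ λ m → IsMinEdgeCount v n m × m ≤ edgeCount G
  minEdgeCount {v} n G ec =
    let m , (p , ecₚ , e) , m-least = least hasSize? (edgeCount G) (sized G ec)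
    in m , ((decode p , ecₚ , e) , λ H ecₕ → m-least (sized H ecₕ)) , m-least (sized G ec)
    where
    HasSize : ℕ → Set
    HasSize m = ∃ λ p → IsExistentiallyClosed n (decode {v} p) × edgeCount (decode {v} p) ≡ m
    hasSize? : Decidable HasSize
    hasSize? m = anySubset? λ p → existentiallyClosed? n (decode {v} p) ×-dec (edgeCount (decode {v} p) ≟ m)
    sized : ∀ H → IsExistentiallyClosed n H → HasSize (edgeCount H)
    sized H ecₕ = encode H
      , existentiallyClosed-resp H (decode (encode H)) (~⇒decode H) (decode⇒~ H) n ecₕ
      , sym (edgeCount-resp H (decode (encode H)) (~⇒decode H) (decode⇒~ H))

-- Choosing the number of hubs for large v.

module Asymptotics where

  open import Data.Nat.Base
  open import Data.Nat.DivMod using (_/_; _%_; m≡m%n+[m/n]*n; m%n<n; m/n*n≤m; m*n/n≡m; /-monoˡ-≤)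
  open import Data.Nat.Properties

  last : ∀ {p} {P : Pred ℕ p} → Decidable P → ∀ a b → P a → ¬ P (a + b) →
         ∃ λ m → a ≤ m × P m × ¬ P (suc m)
  last {P = P} P? a zero    Pa ¬Pb = contradiction Pa (subst (λ i → ¬ P i) (+-identityʳ a) ¬Pb)
  last {P = P} P? a (suc b) Pa ¬Pb with P? (suc a)
  ... | no ¬P = a , ≤-refl , Pa , ¬P
  ... | yes p =
    let m , a<m , Pm , ¬Pm = last P? (suc a) b p (subst (λ i → ¬ P i) (+-suc a b) ¬Pb)
    in m , <⇒≤ a<m , Pm , ¬Pm

  -- Bernoulli's inequality `(1 + 1 / D) ^ x ≥ 1 + x / D`, multiplied by `D ^ (x + 1)`.
  bernoulli : ∀ D x → (D + x) * D ^ x ≤ D * suc D ^ x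
  bernoulli D zero    = ≤-reflexive (cong (_* 1) (+-identityʳ D))
  bernoulli D (suc x) = begin
    (D + suc x) * (D * D ^ x)     ≤⟨ m≤m+n _ (x * D ^ x) ⟩
    (D + suc x) * (D * D ^ x) + x * D ^ x ≡⟨ lemma₁ D x (D ^ x) ⟩
    suc D * ((D + x) * D ^ x)     ≤⟨ *-monoʳ-≤ (suc D) (bernoulli D x) ⟩
    suc D * (D * suc D ^ x)       ≡⟨ lemma₂ D (suc D ^ x) ⟩
    D * (suc D * suc D ^ x)       ∎
    where
    open ≤-Reasoning
    lemma₁ : ∀ D x a → (D + suc x) * (D * a) + x * a ≡ suc D * ((D + x) * a)
    lemma₁ = solve-∀
    lemma₂ : ∀ D a → suc D * (D * a) ≡ D * (suc D * a)
    lemma₂ = solve-∀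

  ^-distribʳ-* : ∀ m n o → (m * n) ^ o ≡ m ^ o * n ^ o
  ^-distribʳ-* m n zero    = refl
  ^-distribʳ-* m n (suc o) = trans (cong (m * n *_) (^-distribʳ-* m n o)) (lemma m n (m ^ o) (n ^ o))
    where
    lemma : ∀ a b c d → a * b * (c * d) ≡ a * c * (b * d)
    lemma = solve-∀

  -- (1 + 1/D)^(3x) ≥ (x / D)³ outgrows any quadratic polynomial.
  cubic : ∀ D x → x ^ 3 * D ^ (3 * x) ≤ D ^ 3 * suc D ^ (3 * x)
  cubic D x = begin
    x ^ 3 * D ^ (3 * x)        ≡⟨ cong (x ^ 3 *_) (pow D) ⟩
    x ^ 3 * (D ^ x) ^ 3        ≡⟨ ^-distribʳ-* x (D ^ x) 3 ⟨
    (x * D ^ x) ^ 3            ≤⟨ ^-monoˡ-≤ 3 (≤-trans (*-monoˡ-≤ (D ^ x) (m≤n+m x D)) (bernoulli D x)) ⟩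
    (D * suc D ^ x) ^ 3        ≡⟨ ^-distribʳ-* D (suc D ^ x) 3 ⟩
    D ^ 3 * (suc D ^ x) ^ 3    ≡⟨ cong (D ^ 3 *_) (pow (suc D)) ⟨
    D ^ 3 * suc D ^ (3 * x)    ∎
    where
    open ≤-Reasoning
    pow : ∀ b → b ^ (3 * x) ≡ (b ^ x) ^ 3
    pow b = trans (cong (b ^_) (*-comm 3 x)) (sym (^-*-assoc b x 3))

  -- L = ⌊ log v / log (M / D) ⌋ - 1 for M = D + 1; the number k of hubs is p L plus
  -- a small multiple of L that pays for the patterns meeting the hubs.
  record Parameters (p D v : ℕ) : Set where
    field
      k v₀ L  : ℕ
      k+v₀≡v  : k + v₀ ≡ v
      k≢0     : NonZero k
      k≤v₀    : k ≤ v₀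
      L-lower : suc D ^ suc L ≤ v * D ^ suc L
      budget  : suc D * (k + 3) ≤ suc (suc D) * p * L
      few     : 4 * (2 + p) * k * ((2 * (k + v₀)) ^ suc p * D ^ k)
                + (2 + k) * (k + v₀) * (k * (2 * (2 * (k + v₀)) ^ p) * (suc D * D ^ k)) ≤ (k + v₀) * suc D ^ k

  module _ (p D : ℕ) .{{_ : NonZero D}} (2≤p : 2 ≤ p) where

    private
      -- `K₁` bounds `k / x`, and `K₂`, which is `poly K₁`, bounds `poly k / x²`. From `X` on,
      -- `x ^ 3` exceeds `K₂ * D ^ 3 * x²`. In `L₀`, the summand `3 * M * X` ensures `X ≤ x`, and
      -- the other one pays for the rounding in `budget′`.
      M K₁ K₂ X L₀ : ℕ
      M  = suc D
      K₁ = 6 * p * M + 3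
      K₂ = 2 ^ p * (8 * (2 + p) * K₁ + 2 * K₁ * (K₁ + 2) * M)
      X  = suc (K₂ * D ^ 3)
      L₀ = 3 * M * X + suc (suc (2 * M * p + 3 * M))

      -- What is left of the left side of `few` after the factor `v * (v ^ p * D ^ k)` is taken out.
      poly : ℕ → ℕ
      poly k = 2 ^ p * (8 * (2 + p) * k + 2 * k * (k + 2) * M)

      instance
        D³≢0 : NonZero (D ^ 3)
        D³≢0 = m^n≢0 D 3

      x≤x² : ∀ x → x ≤ x * x
      x≤x² zero    = z≤n
      x≤x² (suc x) = m≤m*n (suc x) (suc x)

      poly-≤ : ∀ k x → k ≤ K₁ * x → poly k ≤ K₂ * (x * x)
      poly-≤ k x k≤ = begin
        2 ^ p * (8 * (2 + p) * k + 2 * k * (k + 2) * M)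
          ≡⟨ lemma₁ (2 ^ p) p k M ⟩
        2 ^ p * ((8 * (2 + p) + 4 * M) * k + 2 * M * (k * k))
          ≤⟨ *-monoʳ-≤ (2 ^ p) (+-mono-≤ (*-monoʳ-≤ (8 * (2 + p) + 4 * M) (≤-trans k≤ (*-monoʳ-≤ K₁ (x≤x² x))))
                                         (*-monoʳ-≤ (2 * M) (*-mono-≤ k≤ k≤))) ⟩
        2 ^ p * ((8 * (2 + p) + 4 * M) * (K₁ * (x * x)) + 2 * M * (K₁ * x * (K₁ * x)))
          ≡⟨ lemma₂ (2 ^ p) p K₁ M x ⟩
        K₂ * (x * x) ∎
        where
        open ≤-Reasoning
        lemma₁ : ∀ a p k M → a * (8 * (2 + p) * k + 2 * k * (k + 2) * M)
                             ≡ a * ((8 * (2 + p) + 4 * M) * k + 2 * M * (k * k))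
        lemma₁ = solve-∀
        lemma₂ : ∀ a p K M x → a * ((8 * (2 + p) + 4 * M) * (K * (x * x)) + 2 * M * (K * x * (K * x)))
                               ≡ a * (8 * (2 + p) * K + 2 * K * (K + 2) * M) * (x * x)
        lemma₂ = solve-∀

      module _ (v L x : ℕ) (X≤x : X ≤ x) (3Mx≤L : 3 * M * x ≤ L) (L<3M[1+x] : L < 3 * M * suc x)
               (lo : M ^ L ≤ v * D ^ L) (hi : v * D ^ suc L ≤ M ^ suc L) where

        open ≤-Reasoning

        hubCount : ℕ
        hubCount = p * suc L + 3 * x

        private
          k : ℕ
          k = hubCount

        k≤K₁x : k ≤ K₁ * x
        k≤K₁x = begin
          p * suc L + 3 * x             ≤⟨ +-monoˡ-≤ (3 * x) (*-monoʳ-≤ p (≤-trans L<3M[1+x]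
                                             (*-monoʳ-≤ (3 * M) (+-monoˡ-≤ x (≤-trans (s≤s z≤n) X≤x))))) ⟩
          p * (3 * M * (x + x)) + 3 * x ≡⟨ lemma p M x ⟩
          K₁ * x                        ∎
          where
          lemma : ∀ p M x → p * (3 * M * (x + x)) + 3 * x ≡ (6 * p * M + 3) * x
          lemma = solve-∀

        K₂x²D³≤x³ : K₂ * (x * x) * D ^ 3 ≤ x ^ 3
        K₂x²D³≤x³ = begin
          K₂ * (x * x) * D ^ 3   ≡⟨ lemma₁ K₂ (x * x) (D ^ 3) ⟩
          K₂ * D ^ 3 * (x * x)   ≤⟨ *-monoˡ-≤ (x * x) (≤-trans (n≤1+n (K₂ * D ^ 3)) X≤x) ⟩
          x * (x * x)            ≡⟨ cong (λ y → x * (x * y)) (*-identityʳ x) ⟨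
          x ^ 3                  ∎
          where
          lemma₁ : ∀ a b c → a * b * c ≡ a * c * b
          lemma₁ = solve-∀

        poly-decay : poly k * D ^ (3 * x) ≤ M ^ (3 * x)
        poly-decay = *-cancelˡ-≤ (D ^ 3) (begin
          D ^ 3 * (poly k * D ^ (3 * x))         ≤⟨ *-monoʳ-≤ (D ^ 3) (*-monoˡ-≤ (D ^ (3 * x)) (poly-≤ k x k≤K₁x)) ⟩
          D ^ 3 * (K₂ * (x * x) * D ^ (3 * x))   ≡⟨ lemma (D ^ 3) (K₂ * (x * x)) (D ^ (3 * x)) ⟩
          K₂ * (x * x) * D ^ 3 * D ^ (3 * x)     ≤⟨ *-monoˡ-≤ (D ^ (3 * x)) K₂x²D³≤x³ ⟩
          x ^ 3 * D ^ (3 * x)                    ≤⟨ cubic D x ⟩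
          D ^ 3 * M ^ (3 * x)                    ∎)
          where
          lemma : ∀ a b c → a * (b * c) ≡ b * a * c
          lemma = solve-∀

        -- The hubs divide their work: `p * suc L` of them outweigh `v ^ p` by `hi`, and the other
        -- `3 * x` outweigh `poly k` by `poly-decay`.
        few′ : 4 * (2 + p) * k * ((2 * v) ^ suc p * D ^ k)
              + (2 + k) * v * (k * (2 * (2 * v) ^ p) * (M * D ^ k)) ≤ v * M ^ k
        few′ = begin
          4 * (2 + p) * k * (2 * v * (2 * v) ^ p * D ^ k) + (2 + k) * v * (k * (2 * (2 * v) ^ p) * (M * D ^ k))
            ≡⟨ cong (λ a → 4 * (2 + p) * k * (2 * v * a * D ^ k) + (2 + k) * v * (k * (2 * a) * (M * D ^ k)))
                 (^-distribʳ-* 2 v p) ⟩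
          4 * (2 + p) * k * (2 * v * (2 ^ p * v ^ p) * D ^ k) + (2 + k) * v * (k * (2 * (2 ^ p * v ^ p)) * (M * D ^ k))
            ≡⟨ lemma₁ p k v (2 ^ p) (v ^ p) M (D ^ k) ⟩
          v * (poly k * (v ^ p * D ^ k))
            ≡⟨ cong (λ a → v * (poly k * (v ^ p * a))) (split D) ⟩
          v * (poly k * (v ^ p * ((D ^ suc L) ^ p * D ^ (3 * x))))
            ≡⟨ cong (v *_) (lemma₂ (poly k) (v ^ p) ((D ^ suc L) ^ p) (D ^ (3 * x))) ⟩
          v * (v ^ p * (D ^ suc L) ^ p * (poly k * D ^ (3 * x)))
            ≡⟨ cong (λ a → v * (a * (poly k * D ^ (3 * x)))) (^-distribʳ-* v (D ^ suc L) p) ⟨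
          v * ((v * D ^ suc L) ^ p * (poly k * D ^ (3 * x)))
            ≤⟨ *-monoʳ-≤ v (*-mono-≤ (^-monoˡ-≤ p hi) poly-decay) ⟩
          v * ((M ^ suc L) ^ p * M ^ (3 * x))
            ≡⟨ cong (v *_) (split M) ⟨
          v * M ^ k ∎
          where
          split : ∀ b → b ^ k ≡ (b ^ suc L) ^ p * b ^ (3 * x)
          split b = trans (^-distribˡ-+-* b (p * suc L) (3 * x))
            (cong (_* b ^ (3 * x)) (trans (cong (b ^_) (*-comm p (suc L))) (sym (^-*-assoc b (suc L) p))))
          lemma₁ : ∀ p k v t w M d →
            4 * (2 + p) * k * (2 * v * (t * w) * d) + (2 + k) * v * (k * (2 * (t * w)) * (M * d))
            ≡ v * (t * (8 * (2 + p) * k + 2 * k * (k + 2) * M) * (w * d))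
          lemma₁ = solve-∀
          lemma₂ : ∀ a b c d → a * (b * (c * d)) ≡ b * c * (a * d)
          lemma₂ = solve-∀

        -- The chain is `2 * k ≤ poly k ≤ (x / D) ^ 3 ≤ (M / D) ^ (3 * x) ≤ (M / D) ^ L ≤
        -- v`, whose last step is `lo`.
        2k≤v : 2 * k ≤ v
        2k≤v = begin
          2 * k                       ≤⟨ *-monoˡ-≤ k {2} {8 * (2 + p)} (s≤s (s≤s z≤n)) ⟩
          8 * (2 + p) * k             ≤⟨ m≤m+n _ (2 * k * (k + 2) * M) ⟩
          8 * (2 + p) * k + 2 * k * (k + 2) * M ≤⟨ m≤n*m _ (2 ^ p) {{m^n≢0 2 p}} ⟩
          poly k                      ≤⟨ poly-≤ k x k≤K₁x ⟩
          K₂ * (x * x)                ≤⟨ *-cancelʳ-≤ _ _ (D ^ 3) K₂x²D³≤vD³ ⟩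
          v                           ∎
          where
          r : ℕ
          r = L ∸ 3 * x
          3x≤L : 3 * x ≤ L
          3x≤L = ≤-trans (*-monoˡ-≤ x (m≤m*n 3 M)) 3Mx≤L
          split : ∀ b → b ^ L ≡ b ^ (3 * x) * b ^ r
          split b = trans (cong (b ^_) (sym (m+[n∸m]≡n 3x≤L))) (^-distribˡ-+-* b (3 * x) r)
          lemma₁ : ∀ a b c → a * b * c ≡ a * (b * c)
          lemma₁ = solve-∀
          lemma₂ : ∀ a b c → a * (b * c) ≡ b * a * c
          lemma₂ = solve-∀
          K₂x²D³≤vD³ : K₂ * (x * x) * D ^ 3 ≤ v * D ^ 3
          K₂x²D³≤vD³ = ≤-trans K₂x²D³≤x³ (*-cancelʳ-≤ (x ^ 3) (v * D ^ 3) (D ^ L) {{m^n≢0 D L}} (begin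
            x ^ 3 * D ^ L                      ≡⟨ cong (x ^ 3 *_) (split D) ⟩
            x ^ 3 * (D ^ (3 * x) * D ^ r)      ≡⟨ lemma₁ (x ^ 3) (D ^ (3 * x)) (D ^ r) ⟨
            x ^ 3 * D ^ (3 * x) * D ^ r        ≤⟨ *-mono-≤ (cubic D x) (^-monoˡ-≤ r (n≤1+n D)) ⟩
            D ^ 3 * M ^ (3 * x) * M ^ r        ≡⟨ lemma₁ (D ^ 3) (M ^ (3 * x)) (M ^ r) ⟩
            D ^ 3 * (M ^ (3 * x) * M ^ r)      ≡⟨ cong (D ^ 3 *_) (split M) ⟨
            D ^ 3 * M ^ L                      ≤⟨ *-monoʳ-≤ (D ^ 3) lo ⟩
            D ^ 3 * (v * D ^ L)                ≡⟨ lemma₂ (D ^ 3) v (D ^ L) ⟩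
            v * D ^ 3 * D ^ L                  ∎))

      -- Beyond `M * p * L` there are the surplus hubs, at most `L + 1`, and a constant that
      -- together with this 1 is at most `L`. The allowance for both is `p * L`, so `2 ≤ p`, that is
      -- `n ≥ 3`, is what makes them fit.
      budget′ : ∀ L x → suc (2 * M * p + 3 * M) ≤ L → 3 * M * x ≤ suc L →
               M * (p * suc (suc L) + 3 * x + 3) ≤ suc M * p * L
      budget′ L x ≤L 3Mx≤ = begin
        M * (p * suc (suc L) + 3 * x + 3)               ≡⟨ lemma₁ M p L x ⟩
        M * p * L + (2 * M * p + 3 * M + 3 * M * x)     ≤⟨ +-monoʳ-≤ (M * p * L) (+-monoʳ-≤ (2 * M * p + 3 * M) 3Mx≤) ⟩
        M * p * L + (2 * M * p + 3 * M + suc L)         ≡⟨ cong (M * p * L +_) (+-suc (2 * M * p + 3 * M) L) ⟩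
        M * p * L + (suc (2 * M * p + 3 * M) + L)       ≤⟨ +-monoʳ-≤ (M * p * L) (+-monoˡ-≤ L ≤L) ⟩
        M * p * L + (L + L)                             ≡⟨ cong (λ a → M * p * L + (L + a)) (+-identityʳ L) ⟨
        M * p * L + 2 * L                               ≤⟨ +-monoʳ-≤ (M * p * L) (*-monoˡ-≤ L 2≤p) ⟩
        M * p * L + p * L                               ≡⟨ lemma₂ M p L ⟩
        suc M * p * L                                   ∎
        where
        open ≤-Reasoning
        lemma₁ : ∀ M p L x → M * (p * suc (suc L) + 3 * x + 3) ≡ M * p * L + (2 * M * p + 3 * M + 3 * M * x)
        lemma₁ = solve-∀
        lemma₂ : ∀ M p L → M * p * L + p * L ≡ suc M * p * L
        lemma₂ = solve-∀

      L₀-bounds : ∀ {L} → L₀ ≤ suc L → suc (2 * M * p + 3 * M) ≤ L × X ≤ suc L / (3 * M)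
      L₀-bounds {L} L₀≤ = ≤-pred (≤-trans (m≤n+m _ (3 * M * X)) L₀≤)
        , ≤-trans (≤-reflexive (sym (m*n/m≡n (3 * M) X))) (/-monoˡ-≤ (3 * M) (≤-trans (m≤m+n (3 * M * X) _) L₀≤))
        where
        m*n/m≡n : ∀ m n .{{_ : NonZero m}} → m * n / m ≡ n
        m*n/m≡n m n = trans (cong (_/ m) (*-comm m n)) (m*n/n≡m n m)

      choose : ∀ v L → L₀ ≤ suc L → M ^ suc L ≤ v * D ^ suc L → v * D ^ suc (suc L) ≤ M ^ suc (suc L) →
               Parameters p D v
      choose v L L₀≤ lo hi = record
        { k       = k′
        ; v₀      = v ∸ k′
        ; L       = L
        ; k+v₀≡v  = k′+v₀≡v
        ; k≢0     = >-nonZero (≤-trans (*-mono-≤ (≤-trans (s≤s z≤n) 2≤p) (s≤s z≤n)) (m≤m+n (p * suc (suc L)) (3 * x)))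
        ; k≤v₀    = +-cancelˡ-≤ k′ _ _ (≤-trans (≤-reflexive (cong (k′ +_) (sym (+-identityʳ k′))))
                      (≤-trans 2k≤v′ (≤-reflexive (sym k′+v₀≡v))))
        ; L-lower = lo
        ; budget  = budget′ L x (proj₁ (L₀-bounds L₀≤)) 3Mx≤
        ; few     = subst (λ u → 4 * (2 + p) * k′ * ((2 * u) ^ suc p * D ^ k′)
                        + (2 + k′) * u * (k′ * (2 * (2 * u) ^ p) * (M * D ^ k′)) ≤ u * M ^ k′)
                      (sym k′+v₀≡v) (few′ v (suc L) x X≤x 3Mx≤ <3M[1+x] lo hi)
        }
        where
        x k′ : ℕ
        x  = suc L / (3 * M)
        X≤x : X ≤ x
        X≤x = proj₂ (L₀-bounds L₀≤)
        3Mx≤ : 3 * M * x ≤ suc L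
        3Mx≤ = ≤-trans (≤-reflexive (*-comm (3 * M) x)) (m/n*n≤m (suc L) (3 * M))
        <3M[1+x] : suc L < 3 * M * suc x
        <3M[1+x] = begin-strict
          suc L                                ≡⟨ m≡m%n+[m/n]*n (suc L) (3 * M) ⟩
          suc L % (3 * M) + x * (3 * M)        <⟨ +-monoˡ-< (x * (3 * M)) (m%n<n (suc L) (3 * M)) ⟩
          suc x * (3 * M)                      ≡⟨ *-comm (suc x) (3 * M) ⟩
          3 * M * suc x                        ∎
          where open ≤-Reasoning
        k′ = hubCount v (suc L) x X≤x 3Mx≤ <3M[1+x] lo hi
        2k≤v′ : 2 * k′ ≤ v
        2k≤v′ = 2k≤v v (suc L) x X≤x 3Mx≤ <3M[1+x] lo hi
        k′+v₀≡v : k′ + (v ∸ k′) ≡ v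
        k′+v₀≡v = m+[n∸m]≡n (≤-trans (m≤m+n k′ (k′ + 0)) 2k≤v′)

    -- The inequality `M ^ i ≤ v * D ^ i` holds at `i = L₀` once `v ≥ M ^ L₀`. It fails at
    -- `i = L₀ + v * D` by Bernoulli, so it stops holding somewhere in between.
    parameters : ∃ λ V → ∀ v → V ≤ v → Parameters p D v
    parameters = M ^ L₀ , λ v V≤v → exists v (last (λ i → M ^ i ≤? v * D ^ i) L₀ (v * D) (first v V≤v) (unbounded v))
      where
      first : ∀ v → M ^ L₀ ≤ v → M ^ L₀ ≤ v * D ^ L₀
      first v V≤v = ≤-trans V≤v (m≤m*n v (D ^ L₀) {{m^n≢0 D L₀}})
      unbounded : ∀ v → ¬ M ^ (L₀ + v * D) ≤ v * D ^ (L₀ + v * D)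
      unbounded v = <⇒≱ (*-cancelˡ-< D _ _ (begin-strict
        D * (v * D ^ e)      ≡⟨ lemma D v (D ^ e) ⟩
        v * D * D ^ e        <⟨ *-monoˡ-< (D ^ e) {{m^n≢0 D e}}
                                  (≤-trans (m<n+m (v * D) (>-nonZero⁻¹ D)) (+-monoʳ-≤ D (m≤n+m (v * D) L₀))) ⟩
        (D + e) * D ^ e      ≤⟨ bernoulli D e ⟩
        D * M ^ e            ∎))
        where
        open ≤-Reasoning
        e : ℕ
        e = L₀ + v * D
        lemma : ∀ a b c → a * (b * c) ≡ b * a * c
        lemma = solve-∀
      exists : ∀ v → (∃ λ L → L₀ ≤ L × M ^ L ≤ v * D ^ L × ¬ M ^ suc L ≤ v * D ^ suc L) → Parameters p D v
      exists v (zero  , L₀≤ , _)        = contradiction (≤-trans (m≤n+m _ (3 * M * X)) L₀≤) λ ()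
      -- The index found is `suc L`; the recorded `L` is one smaller because the lower bound for the
      -- real logarithm will lose one unit.
      exists v (suc L , L₀≤ , lo , ¬hi) = choose v L L₀≤ lo (<⇒≤ (≰⇒> ¬hi))

open import Defs
open import Data.Integer.Base as ℤ using (ℤ; +_)
import Data.Integer.Properties as ℤ
open import Data.Nat.Base as ℕ using (ℕ; zero; suc)
import Data.Nat.Properties as ℕ
open import Data.Rational.Base as ℚ using (ℚ; 0ℚ; ↥_; ↧ₙ_; _/_)
import Data.Rational.Properties as ℚ
import Data.Rational.Unnormalised.Base as ℚᵘ
import Data.Rational.Unnormalised.Properties as ℚᵘ

-- Rational inequalities and segments of the harmonic series.

n/d-nonNeg : ∀ a b .{{_ : ℕ.NonZero b}} → 0ℚ ℚ.≤ (+ a) / b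
n/d-nonNeg a b = ℚ.nonNegative⁻¹ ((+ a) / b) {{ℚ.normalize-nonNeg a b}}

/-*-/ : ∀ a b c d .{{_ : ℕ.NonZero b}} .{{_ : ℕ.NonZero d}} .{{_ : ℕ.NonZero (b ℕ.* d)}} →
        ((+ a) / b) ℚ.* ((+ c) / d) ≡ (+ (a ℕ.* c)) / (b ℕ.* d)
/-*-/ a b@(suc _) c d@(suc _) = ℚ.toℚᵘ-injective (begin-equality
  ℚ.toℚᵘ (((+ a) / b) ℚ.* ((+ c) / d))          ≃⟨ ℚ.toℚᵘ-homo-* ((+ a) / b) ((+ c) / d) ⟩
  ℚ.toℚᵘ ((+ a) / b) ℚᵘ.* ℚ.toℚᵘ ((+ c) / d)    ≃⟨ ℚᵘ.*-cong (ℚ.toℚᵘ-fromℚᵘ ((+ a) ℚᵘ./ b)) (ℚ.toℚᵘ-fromℚᵘ ((+ c) ℚᵘ./ d)) ⟩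
  ((+ a) ℚᵘ./ b) ℚᵘ.* ((+ c) ℚᵘ./ d)            ≃⟨ ℚᵘ.*≡* (cong (ℤ._* + (b ℕ.* d)) (sym (ℤ.pos-* a c))) ⟩
  (+ (a ℕ.* c)) ℚᵘ./ (b ℕ.* d)                  ≃⟨ ℚ.toℚᵘ-fromℚᵘ ((+ (a ℕ.* c)) ℚᵘ./ (b ℕ.* d)) ⟨
  ℚ.toℚᵘ ((+ (a ℕ.* c)) / (b ℕ.* d))            ∎)
  where open ℚᵘ.≤-Reasoning

*-mono-≤ : ∀ {p q r s} → 0ℚ ℚ.≤ r → 0ℚ ℚ.≤ q → p ℚ.≤ q → r ℚ.≤ s → p ℚ.* r ℚ.≤ q ℚ.* s
*-mono-≤ {p} {q} {r} {s} 0≤r 0≤q p≤q r≤s = ℚ.≤-trans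
  (ℚ.*-monoʳ-≤-nonNeg r {{ℚ.nonNegative 0≤r}} p≤q)
  (ℚ.*-monoˡ-≤-nonNeg q {{ℚ.nonNegative 0≤q}} r≤s)

+-cancelʳ-≤ : ∀ r {p q} → p ℚ.+ r ℚ.≤ q ℚ.+ r → p ℚ.≤ q
+-cancelʳ-≤ r {p} {q} h = subst₂ ℚ._≤_ (lemma p) (lemma q) (ℚ.+-monoˡ-≤ (ℚ.- r) h)
  where
  lemma : ∀ p → p ℚ.+ r ℚ.+ ℚ.- r ≡ p
  lemma p = ℚS.solve 2 (λ p r → p ℚS.:+ r ℚS.:+ ℚS.:- r ℚS.:= p) refl p r

-- The difference of harmonic numbers with indices `a + l` and `a`; `logSum w N` is
-- `harmonic N (w * N)`.
harmonic : ℕ → ℕ → ℚ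
harmonic a l = Σ< l (λ j → (+ 1) / suc (a ℕ.+ j))

harmonic-≥ : ∀ a l .{{_ : ℕ.NonZero (a ℕ.+ l)}} → (+ l) / (a ℕ.+ l) ℚ.≤ harmonic a l
harmonic-≥ a l = ℚ.≤-trans (ℚ.≤-reflexive (sym (Σ<-const l (a ℕ.+ l))))
  (Σ<-mono l λ j j<l → /-≤ 1 (a ℕ.+ l) 1 (suc (a ℕ.+ j))
    (ℕ.*-monoʳ-≤ 1 (ℕ.≤-trans (ℕ.≤-reflexive (sym (ℕ.+-suc a j))) (ℕ.+-monoʳ-≤ a j<l))))

harmonic-++ : ∀ a l m → harmonic a (l ℕ.+ m) ≡ harmonic a l ℚ.+ harmonic (a ℕ.+ l) m
harmonic-++ a l m = trans (Σ<-+ l m _)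
  (cong (harmonic a l ℚ.+_) (Σ<-cong m λ j → cong (λ k → (+ 1) / suc k) (sym (ℕ.+-assoc a l j))))

harmonic-nonNeg : ∀ a l → 0ℚ ℚ.≤ harmonic a l
harmonic-nonNeg a zero    = ℚ.≤-refl
harmonic-nonNeg a (suc l) = ℚ.+-mono-≤ (harmonic-nonNeg a l) (n/d-nonNeg 1 (suc (a ℕ.+ l)))

harmonic-mono : ∀ a {l m} → l ℕ.≤ m → harmonic a l ℚ.≤ harmonic a m
harmonic-mono a {l} l≤m with ℕ.m≤n⇒∃[o]m+o≡n l≤m
... | o , refl = begin
  harmonic a l                              ≡⟨ ℚ.+-identityʳ (harmonic a l) ⟨
  harmonic a l ℚ.+ 0ℚ                       ≤⟨ ℚ.+-monoʳ-≤ (harmonic a l) (harmonic-nonNeg (a ℕ.+ l) o) ⟩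
  harmonic a l ℚ.+ harmonic (a ℕ.+ l) o     ≡⟨ harmonic-++ a l o ⟨
  harmonic a (l ℕ.+ o)                      ∎
  where open ℚ.≤-Reasoning

-- A lower bound for the logarithm.

module _ (D : ℕ) .{{_ : ℕ.NonZero D}} where

  private
    M = suc D

  -- The sum over (Dⁱ c , Mⁱ c] splits at Dⁱ⁻¹M c, …, D Mⁱ⁻¹c into i blocks, each at least 1 - D / M.
  harmonic-blocks : ∀ i c .{{_ : ℕ.NonZero c}} →
    ∃ λ l → D ℕ.^ i ℕ.* c ℕ.+ l ≡ M ℕ.^ i ℕ.* c × (+ i) / M ℚ.≤ harmonic (D ℕ.^ i ℕ.* c) l
  harmonic-blocks zero    c = 0 , ℕ.+-identityʳ (1 ℕ.* c) , ℚ.≤-reflexive (ℚ.0/n≡0 M)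
  harmonic-blocks (suc i) c with harmonic-blocks i (D ℕ.* c) {{ℕ.m*n≢0 D c}}
  ... | l , e , h = l ℕ.+ b , right , subst (λ a → (+ suc i) / M ℚ.≤ harmonic a (l ℕ.+ b)) (sym left) (begin
    (+ suc i) / M                                     ≡⟨ suc-/ i M ⟩
    (+ i) / M ℚ.+ (+ 1) / M                           ≤⟨ ℚ.+-mono-≤ h block ⟩
    harmonic a l ℚ.+ harmonic (a ℕ.+ l) b             ≡⟨ harmonic-++ a l b ⟨
    harmonic a (l ℕ.+ b)                              ∎)
    where
    open ℚ.≤-Reasoning
    a b : ℕ
    a = D ℕ.^ i ℕ.* (D ℕ.* c)
    b = M ℕ.^ i ℕ.* c
    lemma₁ : ∀ p D c → D ℕ.* p ℕ.* c ≡ p ℕ.* (D ℕ.* c)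
    lemma₁ = solve-∀
    lemma₂ : ∀ p D c → p ℕ.* (D ℕ.* c) ℕ.+ p ℕ.* c ≡ suc D ℕ.* (p ℕ.* c)
    lemma₂ = solve-∀
    left : D ℕ.^ suc i ℕ.* c ≡ a
    left = lemma₁ (D ℕ.^ i) D c
    a+l+b : a ℕ.+ l ℕ.+ b ≡ M ℕ.* b
    a+l+b = trans (cong (ℕ._+ b) e) (lemma₂ (M ℕ.^ i) D c)
    right : D ℕ.^ suc i ℕ.* c ℕ.+ (l ℕ.+ b) ≡ M ℕ.^ suc i ℕ.* c
    right = trans (cong (ℕ._+ (l ℕ.+ b)) left)
      (trans (sym (ℕ.+-assoc a l b)) (trans a+l+b (sym (ℕ.*-assoc M (M ℕ.^ i) c))))
    instance
      b≢0 : ℕ.NonZero b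
      b≢0 = ℕ.m*n≢0 (M ℕ.^ i) c {{ℕ.m^n≢0 M i}}
      Mb≢0 : ℕ.NonZero (M ℕ.* b)
      Mb≢0 = ℕ.m*n≢0 M b
      sum≢0 : ℕ.NonZero (a ℕ.+ l ℕ.+ b)
      sum≢0 = subst ℕ.NonZero (sym a+l+b) Mb≢0
    block : (+ 1) / M ℚ.≤ harmonic (a ℕ.+ l) b
    block = ℚ.≤-trans
      (/-≤ 1 M b (a ℕ.+ l ℕ.+ b)
        (ℕ.≤-reflexive (trans (ℕ.*-identityˡ (a ℕ.+ l ℕ.+ b)) (trans a+l+b (ℕ.*-comm M b)))))
      (harmonic-≥ (a ℕ.+ l) b)

  -- With mesh `1 / D ^ L` all points `(M / D) ^ i` with `i ≤ L` lie on the grid, so the integral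
  -- splits into blocks without rounding.
  logSum-≥ : ∀ w L → M ℕ.^ L ℕ.≤ suc w ℕ.* D ℕ.^ L → (+ L) / M ℚ.≤ logSum w (D ℕ.^ L)
  logSum-≥ w L M^L≤ with harmonic-blocks L 1
  ... | l , e , h = ℚ.≤-trans
    (subst (λ a → (+ L) / M ℚ.≤ harmonic a l) (ℕ.*-identityʳ (D ℕ.^ L)) h)
    (harmonic-mono (D ℕ.^ L) (ℕ.+-cancelˡ-≤ (D ℕ.^ L) l (w ℕ.* D ℕ.^ L) (begin
      D ℕ.^ L ℕ.+ l                ≡⟨ cong (ℕ._+ l) (ℕ.*-identityʳ (D ℕ.^ L)) ⟨
      D ℕ.^ L ℕ.* 1 ℕ.+ l          ≡⟨ e ⟩
      M ℕ.^ L ℕ.* 1                ≡⟨ ℕ.*-identityʳ (M ℕ.^ L) ⟩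
      M ℕ.^ L                      ≤⟨ M^L≤ ⟩
      suc w ℕ.* D ℕ.^ L            ∎)))
    where open ℕ.≤-Reasoning

  module _ (w L N : ℕ) (M^L≤ : M ℕ.^ suc L ℕ.≤ suc w ℕ.* D ℕ.^ suc L)
    (close : ∀ m n → N ℕ.≤ m → N ℕ.≤ n →
             ℚ.∣ logSum w (suc m) ℚ.- logSum w (suc n) ∣ ℚ.≤ (+ 1) / M) where

    private
      t m : ℕ
      t = D ℕ.^ suc L
      m = ℕ.pred (t ℕ.* suc N)
      instance
        t≢0 : ℕ.NonZero t
        t≢0 = ℕ.m^n≢0 D (suc L)
        tN≢0 : ℕ.NonZero (t ℕ.* suc N)
        tN≢0 = ℕ.m*n≢0 t (suc N)
      N≤m : N ℕ.≤ m
      N≤m = ℕ.≤-pred (ℕ.≤-trans (ℕ.m≤n*m (suc N) t) (ℕ.≤-reflexive (sym (ℕ.suc-pred (t ℕ.* suc N)))))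
      p≤∣p∣ : ∀ p → p ℚ.≤ ℚ.∣ p ∣
      p≤∣p∣ p with ℚ.≤-total 0ℚ p
      ... | inj₁ 0≤p = ℚ.≤-reflexive (sym (ℚ.0≤p⇒∣p∣≡p 0≤p))
      ... | inj₂ p≤0 = ℚ.≤-trans p≤0 (ℚ.0≤∣p∣ p)

    -- The block bound holds at the mesh `1 / t`, and refinement carries it only to multiples of
    -- `t`, one of which is `t * suc N`, with index `m ≥ N`. The Cauchy property takes it from there
    -- to every `i ≥ N` at a loss of `1 / M`: this is one block, hence `suc L` in the hypothesis and
    -- `L` here.
    eventually-logSum-≥ : ∀ i → N ℕ.≤ i → (+ L) / M ℚ.≤ logSum w (suc i)
    eventually-logSum-≥ i N≤i = +-cancelʳ-≤ ((+ 1) / M) (begin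
      (+ L) / M ℚ.+ (+ 1) / M   ≡⟨ suc-/ L M ⟨
      (+ suc L) / M             ≤⟨ logSum-≥ w (suc L) M^L≤ ⟩
      logSum w t                ≤⟨ logSum-refine w t (suc N) ⟩
      logSum w (t ℕ.* suc N)    ≡⟨ cong (logSum w) (ℕ.suc-pred (t ℕ.* suc N)) ⟨
      xₘ                        ≡⟨ ℚS.solve 2 (λ a b → a ℚS.:= b ℚS.:+ (a ℚS.:- b)) refl xₘ xᵢ ⟩
      xᵢ ℚ.+ (xₘ ℚ.- xᵢ)        ≤⟨ ℚ.+-monoʳ-≤ xᵢ (ℚ.≤-trans (p≤∣p∣ (xₘ ℚ.- xᵢ)) (close m i N≤m N≤i)) ⟩
      xᵢ ℚ.+ (+ 1) / M          ∎)
      where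
      open ℚ.≤-Reasoning
      xₘ xᵢ : ℚ
      xₘ = logSum w (suc m)
      xᵢ = logSum w (suc i)

  log-≥ : ∀ w L → M ℕ.^ suc L ℕ.≤ suc w ℕ.* D ℕ.^ suc L →
          ∃ λ N → ∀ i → N ℕ.≤ i → (+ L) / M ℚ.≤ approx (log (suc w)) i
  log-≥ w L M^L≤ =
    let N , close = cauchy (log (suc w)) ((+ 1) / M) (ℚ.positive⁻¹ ((+ 1) / M) {{ℚ.normalize-pos 1 M}})
    in N , eventually-logSum-≥ w L N M^L≤ close

-- A lower bound for the half-integral power of 2.

numerator*d≡denominator : ∀ q d .{{_ : ℕ.NonZero d}} → ℚ.toℚᵘ q ℚᵘ.≃ (+ 1) ℚᵘ./ d →
                          ℤ.∣ ↥ q ∣ ℕ.* d ≡ ↧ₙ q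
numerator*d≡denominator q@(ℚ.mkℚ a b _) d@(suc _) (ℚᵘ.*≡* e) = trans (sym (ℤ.abs-* a (+ d)))
  (trans (cong ℤ.∣_∣ e) (trans (ℤ.abs-* (+ 1) (+ suc b)) (ℕ.*-identityˡ (suc b))))

-- `⌊_√_⌋` reads the numerator and denominator of the normalised fraction. This relation replaces a
-- computation of its gcd.
unit-fraction : ∀ d .{{_ : ℕ.NonZero d}} → ℤ.∣ ↥ ((+ 1) / d) ∣ ℕ.* d ≡ ↧ₙ ((+ 1) / d)
unit-fraction d@(suc _) = numerator*d≡denominator ((+ 1) / d) d (ℚ.toℚᵘ-fromℚᵘ ((+ 1) ℚᵘ./ d))

-- The hypothesis says `√(1 / d) ≥ 2 / M`, and the spare factor 2 absorbs the rounding: if the floor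
-- `j` had `j * M < s`, then `suc j * M ≤ 2 * s` because `M ≤ s`, contrary to `√-upper`.
√-≥ : ∀ M s d .{{_ : ℕ.NonZero M}} .{{_ : ℕ.NonZero s}} .{{_ : ℕ.NonZero d}} → 4 ℕ.* d ℕ.≤ M ℕ.* M → M ℕ.≤ s →
      s ℕ.≤ ⌊ s √ (+ 1) / d ⌋ ℕ.* M
√-≥ M s d 4d≤M² M≤s = ℕ.≮⇒≥ λ jM<s → ℕ.<⇒≱ (√-upper s q) (ℕ.*-cancelʳ-≤ _ _ (M ℕ.* M) {{ℕ.m*n≢0 M M}} (begin
  suc j ℕ.* suc j ℕ.* ↧ₙ q ℕ.* (M ℕ.* M)       ≡⟨ lemma₁ (suc j) (↧ₙ q) M ⟩
  (suc j ℕ.* M) ℕ.* (suc j ℕ.* M) ℕ.* ↧ₙ q     ≤⟨ ℕ.*-monoˡ-≤ (↧ₙ q) (ℕ.*-mono-≤ (2s jM<s) (2s jM<s)) ⟩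
  (s ℕ.+ s) ℕ.* (s ℕ.+ s) ℕ.* ↧ₙ q             ≡⟨ cong ((s ℕ.+ s) ℕ.* (s ℕ.+ s) ℕ.*_) (unit-fraction d) ⟨
  (s ℕ.+ s) ℕ.* (s ℕ.+ s) ℕ.* (a ℕ.* d)        ≡⟨ lemma₂ s a d ⟩
  a ℕ.* (s ℕ.* s) ℕ.* (4 ℕ.* d)                ≤⟨ ℕ.*-monoʳ-≤ (a ℕ.* (s ℕ.* s)) 4d≤M² ⟩
  a ℕ.* (s ℕ.* s) ℕ.* (M ℕ.* M)                ∎))
  where
  open ℕ.≤-Reasoning
  q : ℚ
  q = (+ 1) / d
  a j : ℕ
  a = ℤ.∣ ↥ q ∣
  j = ⌊ s √ q ⌋
  2s : j ℕ.* M ℕ.< s → suc j ℕ.* M ℕ.≤ s ℕ.+ s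
  2s jM<s = ℕ.+-mono-≤ M≤s (ℕ.<⇒≤ jM<s)
  lemma₁ : ∀ j d M → j ℕ.* j ℕ.* d ℕ.* (M ℕ.* M) ≡ (j ℕ.* M) ℕ.* (j ℕ.* M) ℕ.* d
  lemma₁ = solve-∀
  lemma₂ : ∀ s a d → (s ℕ.+ s) ℕ.* (s ℕ.+ s) ℕ.* (a ℕ.* d) ≡ a ℕ.* (s ℕ.* s) ℕ.* (4 ℕ.* d)
  lemma₂ = solve-∀

-- The exponent `3 - n` is `- j`, and `2 ^ (- j / 2)` exceeds `2 ^ (- 3 - j)` by at least a factor
-- 8. The cases follow `2^ℤ`, which treats the exponent 0 and negative exponents by different
-- clauses.
2^[/2]-≥ : ∀ j → let n = 3 ℕ.+ j in ∀ i → 2 ℕ.^ n ℕ.≤ i →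
           ((+ 1) / 2 ℕ.^ n) {{ℕ.m^n≢0 2 n}} ℚ.≤ approx 2^[ + 3 ℤ.- + n /2] i
2^[/2]-≥ zero    i M≤i = /-≤ 1 8 ⌊ suc i √ (+ 1) / 1 ⌋ (suc i)
  (ℕ.≤-trans (ℕ.≤-reflexive (ℕ.*-identityˡ (suc i)))
    (√-≥ 8 (suc i) 1 (ℕ.m≤m+n 4 60) (ℕ.m≤n⇒m≤1+n M≤i)))
2^[/2]-≥ (suc j) i M≤i = /-≤ 1 M ⌊ suc i √ (+ 1) / d ⌋ (suc i)
  (ℕ.≤-trans (ℕ.≤-reflexive (ℕ.*-identityˡ (suc i))) (√-≥ M (suc i) d 4d≤M² (ℕ.m≤n⇒m≤1+n M≤i)))
  where
  d M : ℕ
  d = 2 ℕ.^ suc j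
  M = 2 ℕ.^ (4 ℕ.+ j)
  instance
    d≢0 : ℕ.NonZero d
    d≢0 = ℕ.m^n≢0 2 (suc j)
    M≢0 : ℕ.NonZero M
    M≢0 = ℕ.m^n≢0 2 (4 ℕ.+ j)
  4d≤M² : 4 ℕ.* d ℕ.≤ M ℕ.* M
  4d≤M² = ℕ.≤-trans
    (ℕ.≤-trans (ℕ.*-monoˡ-≤ d {4} {8} (ℕ.m≤m+n 4 4)) (ℕ.≤-reflexive (lemma d)))
    (ℕ.m≤m*n M M)
    where
    lemma : ∀ d → 8 ℕ.* d ≡ 2 ℕ.* (2 ℕ.* (2 ℕ.* d))
    lemma = solve-∀

coefficient-≤ : ∀ D p h v L m {s l} → let M = suc D in
  (+ 1) / M ℚ.≤ s → (+ L) / M ℚ.≤ l → m ℕ.* (M ℕ.* M) ℕ.≤ suc M ℕ.* p ℕ.* h ℕ.* v ℕ.* L →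
  (+ m) / 1 ℚ.≤ (((+ 1) / 1 ℚ.+ s) ℚ.* ((+ p) / 1) ℚ.* ((+ h) / 1) ℚ.+ 0ℚ) ℚ.* ((+ v) / 1) ℚ.* l
coefficient-≤ D p h v L m {s} {l} s≥ l≥ budget = begin
  (+ m) / 1
    -- The fraction `c / M²` is the right side with `s` and `l` replaced by their lower bounds
    -- `1 / M` and `L / M`; the summand `0ℚ` there is the error term.
    ≤⟨ /-≤ m 1 c (M₁ ℕ.* M) (subst (λ d → m ℕ.* d ℕ.≤ c ℕ.* 1) (sym d≡)
         (ℕ.≤-trans budget (ℕ.≤-reflexive (sym (ℕ.*-identityʳ c))))) ⟩
  (+ c) / (M₁ ℕ.* M)
    ≡⟨ /-*-/ (suc M ℕ.* p ℕ.* h ℕ.* v) M₁ L M ⟨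
  ((+ (suc M ℕ.* p ℕ.* h ℕ.* v)) / M₁) ℚ.* ((+ L) / M)
    ≡⟨ cong (ℚ._* ((+ L) / M)) (trans
         (cong (ℚ._* ((+ v) / 1)) (trans
           (cong (ℚ._* ((+ h) / 1)) (/-*-/ (suc M) M p 1))
           (/-*-/ (suc M ℕ.* p) (M ℕ.* 1) h 1)))
         (/-*-/ (suc M ℕ.* p ℕ.* h) (M ℕ.* 1 ℕ.* 1) v 1)) ⟨
  ((+ suc M) / M) ℚ.* ((+ p) / 1) ℚ.* ((+ h) / 1) ℚ.* ((+ v) / 1) ℚ.* ((+ L) / M)
    ≤⟨ *-mono-≤ (n/d-nonNeg L M) v*≥0
         (*-monoʳ v (ℚ.≤-trans (*-monoʳ h (*-monoʳ p 1+s≥)) (ℚ.≤-reflexive (sym (ℚ.+-identityʳ _))))) l≥ ⟩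
  ((1+s ℚ.* ((+ p) / 1) ℚ.* ((+ h) / 1)) ℚ.+ 0ℚ) ℚ.* ((+ v) / 1) ℚ.* l ∎
  where
  open ℚ.≤-Reasoning
  M M₁ c : ℕ
  M  = suc D
  M₁ = M ℕ.* 1 ℕ.* 1 ℕ.* 1
  c  = suc M ℕ.* p ℕ.* h ℕ.* v ℕ.* L
  d≡ : M₁ ℕ.* M ≡ M ℕ.* M
  d≡ = lemma M
    where
    lemma : ∀ M → M ℕ.* 1 ℕ.* 1 ℕ.* 1 ℕ.* M ≡ M ℕ.* M
    lemma = solve-∀
  1+s : ℚ
  1+s = (+ 1) / 1 ℚ.+ s
  1+s≥ : (+ suc M) / M ℚ.≤ 1+s
  1+s≥ = ℚ.≤-trans (ℚ.≤-reflexive (suc-/ M M))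
    (ℚ.+-mono-≤ (/-≤ M M 1 1 (ℕ.≤-reflexive (ℕ.*-comm M 1))) s≥)
  *-monoʳ : ∀ a {q r} → q ℚ.≤ r → q ℚ.* ((+ a) / 1) ℚ.≤ r ℚ.* ((+ a) / 1)
  *-monoʳ a = ℚ.*-monoʳ-≤-nonNeg ((+ a) / 1) {{ℚ.normalize-nonNeg a 1}}
  *≥0 : ∀ a {q} → 0ℚ ℚ.≤ q → 0ℚ ℚ.≤ q ℚ.* ((+ a) / 1)
  *≥0 a {q} 0≤q = ℚ.≤-trans (ℚ.≤-reflexive (sym (ℚ.*-zeroˡ ((+ a) / 1)))) (*-monoʳ a 0≤q)
  v*≥0 : 0ℚ ℚ.≤ (1+s ℚ.* ((+ p) / 1) ℚ.* ((+ h) / 1) ℚ.+ 0ℚ) ℚ.* ((+ v) / 1)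
  v*≥0 = *≥0 v (ℚ.+-mono-≤ (*≥0 h (*≥0 p (ℚ.≤-trans (n/d-nonNeg (suc M) M) 1+s≥))) ℚ.≤-refl)

zero-tendsToZero : TendsToZero (λ _ → fromℚ 0ℚ)
zero-tendsToZero ε 0<ε = 0 , λ _ _ δ 0<δ → 0 , λ _ _ → ℚ.<⇒≤ (ℚ.+-mono-< 0<ε 0<δ)

module _ (j : ℕ) where

  private
    p n D M h : ℕ
    p = 2 ℕ.+ j
    n = suc p
    M = 2 ℕ.^ n
    h = 2 ℕ.^ p
    D = ℕ.pred M

    instance
      M≢0 : ℕ.NonZero M
      M≢0 = ℕ.m^n≢0 2 n

    1+D≡M : suc D ≡ M
    1+D≡M = ℕ.suc-pred M

    1≤D : 1 ℕ.≤ D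
    1≤D = ℕ.≤-pred (ℕ.≤-trans (ℕ.^-monoʳ-≤ 2 {1} {n} (ℕ.s≤s ℕ.z≤n)) (ℕ.≤-reflexive (sym 1+D≡M)))

    D≢0 : ℕ.NonZero D
    D≢0 = ℕ.>-nonZero 1≤D

    C : ℝ
    C = (fromℕ 1 + 2^[ (+ 3) ℤ.- (+ n) /2]) * fromℕ (n ℕ.∸ 1) * fromℕ (2 ℕ.^ (n ℕ.∸ 1)) + fromℚ 0ℚ

    size-≤ : ∀ v k L m → suc D ℕ.* (k ℕ.+ 3) ℕ.≤ suc (suc D) ℕ.* p ℕ.* L → 2 ℕ.* m ℕ.≤ (k ℕ.+ 3) ℕ.* v →
             m ℕ.* (suc D ℕ.* suc D) ℕ.≤ suc (suc D) ℕ.* p ℕ.* h ℕ.* v ℕ.* L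
    size-≤ v k L m budget m≤ = begin
      m ℕ.* (suc D ℕ.* suc D)                        ≡⟨ cong (λ a → m ℕ.* (a ℕ.* suc D)) 1+D≡M ⟩
      m ℕ.* (2 ℕ.* h ℕ.* suc D)                      ≡⟨ lemma₁ m h (suc D) ⟩
      h ℕ.* suc D ℕ.* (2 ℕ.* m)                      ≤⟨ ℕ.*-monoʳ-≤ (h ℕ.* suc D) m≤ ⟩
      h ℕ.* suc D ℕ.* ((k ℕ.+ 3) ℕ.* v)              ≡⟨ lemma₂ h (suc D) (k ℕ.+ 3) v ⟩
      h ℕ.* v ℕ.* (suc D ℕ.* (k ℕ.+ 3))              ≤⟨ ℕ.*-monoʳ-≤ (h ℕ.* v) budget ⟩
      h ℕ.* v ℕ.* (suc (suc D) ℕ.* p ℕ.* L)          ≡⟨ lemma₃ h v (suc (suc D)) p L ⟩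
      suc (suc D) ℕ.* p ℕ.* h ℕ.* v ℕ.* L            ∎
      where
      open ℕ.≤-Reasoning
      lemma₁ : ∀ m h M → m ℕ.* (2 ℕ.* h ℕ.* M) ≡ h ℕ.* M ℕ.* (2 ℕ.* m)
      lemma₁ = solve-∀
      lemma₂ : ∀ h M k v → h ℕ.* M ℕ.* (k ℕ.* v) ≡ h ℕ.* v ℕ.* (M ℕ.* k)
      lemma₂ = solve-∀
      lemma₃ : ∀ h v M p L → h ℕ.* v ℕ.* (M ℕ.* p ℕ.* L) ≡ M ℕ.* p ℕ.* h ℕ.* v ℕ.* L
      lemma₃ = solve-∀

    real-≤ : ∀ w L m → suc D ℕ.^ suc L ℕ.≤ suc w ℕ.* D ℕ.^ suc L →
             m ℕ.* (suc D ℕ.* suc D) ℕ.≤ suc (suc D) ℕ.* p ℕ.* h ℕ.* suc w ℕ.* L →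
             fromℕ m ≤ C * fromℕ (suc w) * log (suc w)
    real-≤ w L m L≤ m≤ ε 0<ε =
      let N , log≥ = log-≥ D {{D≢0}} w L L≤
      in M ℕ.⊔ N , λ i ≤i → ℚ.≤-trans
           (coefficient-≤ D p h (suc w) L m
             (ℚ.≤-trans (/-≤ 1 (suc D) 1 M (ℕ.*-monoʳ-≤ 1 (ℕ.≤-reflexive (sym 1+D≡M))))
                        (2^[/2]-≥ j i (ℕ.m⊔n≤o⇒m≤o M N ≤i)))
             (log≥ i (ℕ.m⊔n≤o⇒n≤o M N ≤i)) m≤)
           (ℚ.≤-trans (ℚ.≤-reflexive (sym (ℚ.+-identityʳ (rhs i)))) (ℚ.+-monoʳ-≤ (rhs i) (ℚ.<⇒≤ 0<ε)))
      where
      rhs : ℕ → ℚ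
      rhs = approx (C * fromℕ (suc w) * log (suc w))

    bounded : ∀ w → Asymptotics.Parameters p D (suc w) →
              ∃ λ m → IsMinEdgeCount (suc w) n m × fromℕ m ≤ C * fromℕ (suc w) * log (suc w)
    bounded w P =
      let G , ec , e≤ = sparse
          m , min , m≤ = Graphs.minEdgeCount n G ec
      in m , min , real-≤ w L m L-lower
           (size-≤ (suc w) k L m budget (ℕ.≤-trans (ℕ.*-monoʳ-≤ 2 m≤) e≤))
      where
      open Asymptotics.Parameters P
      sparse : ∃ λ (G : Graph (suc w)) → IsExistentiallyClosed n G × 2 ℕ.* edgeCount G ℕ.≤ (k ℕ.+ 3) ℕ.* suc w
      sparse = subst (λ v → ∃ λ (G : Graph v) → IsExistentiallyClosed n G × 2 ℕ.* edgeCount G ℕ.≤ (k ℕ.+ 3) ℕ.* v)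
        k+v₀≡v
        (Graphs.sparse-graph k v₀ p D {{k≢0}} 1+D≡M 1≤D k≤v₀
          (subst (λ M → 4 ℕ.* suc (suc p) ℕ.* k ℕ.* ((2 ℕ.* (k ℕ.+ v₀)) ℕ.^ suc p ℕ.* D ℕ.^ k)
                        ℕ.+ suc (suc k) ℕ.* (k ℕ.+ v₀) ℕ.* (k ℕ.* (2 ℕ.* (2 ℕ.* (k ℕ.+ v₀)) ℕ.^ p) ℕ.* (M ℕ.* D ℕ.^ k))
                        ℕ.≤ (k ℕ.+ v₀) ℕ.* M ℕ.^ k)
            1+D≡M few))

  minEdgeCount-≤ : ∃ λ V → ∀ v → V ℕ.≤ v →
    ∃ λ m → IsMinEdgeCount v n m × fromℕ m ≤ C * fromℕ v * log v
  minEdgeCount-≤ =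
    let V , params = Asymptotics.parameters p D {{D≢0}} (ℕ.m≤m+n 2 j)
    in suc V , λ { (suc w) (ℕ.s≤s V≤w) → bounded w (params (suc w) (ℕ.m≤n⇒m≤1+n V≤w)) }

theorem17 : (n : ℕ) → 3 ℕ.≤ n →
    ∃ λ (o : ℕ → ℝ) → TendsToZero o ×
    ∃ λ V → ∀ v → V ℕ.≤ v → ∃ λ m → IsMinEdgeCount v n m ×
    fromℕ m ≤
    ((fromℕ 1 + 2^[ (+ 3) ℤ.- (+ n) /2])
    * fromℕ (n ℕ.∸ 1) * fromℕ (2 ℕ.^ (n ℕ.∸ 1)) + o v)
    * fromℕ v * log v
theorem17 (suc (suc (suc j))) (ℕ.s≤s (ℕ.s≤s (ℕ.s≤s ℕ.z≤n))) =
  (λ _ → fromℚ 0ℚ) , zero-tendsToZero , minEdgeCount-≤ j
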